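{- Let $k,\ell,s$ be positive integers with $k\geq 4$, $\ell\geq 3$ and $s\geq k\ell$. There is a constant $c(k,s)>0$ depending only on $k$ and $s$ such that the following holds for every $n$. Let $\mathcal{F}$ be a family of $k$-subsets of $[n]$. If $k=4$, suppose $\mathcal{F}$ contains no member of $\mathcal{C}^{(4)}_\ell$; if $k\geq 5$, suppose $\mathcal{F}$ does not contain $\mathbb{C}^{(k)}_\ell$. Then $\mathcal{F}$ can be partitioned into subfamilies $\mathcal{F}_1,\mathcal{F}_0$ such that $\mathcal{F}_1$ is centralized with threshold $s$ and $|\mathcal{F}_0|\leq \frac{1}{c(k,s)}\binom{n}{k-2}$.
   Context: An $s$-star with kernel $D$ is a collection of $s$ sets pairwise intersecting exactly in $D$, each strictly containing $D$. The kernel degree $\deg^*_{\mathcal{G}}(D)$ is the largest $s$ such that $\mathcal{G}$ contains an $s$-star with kernel $D$, and $\mathrm{Ker}_s(\mathcal{G})=\{D:\deg^*_{\mathcal{G}}(D)\geq s\}$. A family $\mathcal{G}$ is centralized with threshold $s$ if for every $F\in\mathcal{G}$ there is an element $c(F)\in F$ such that every proper subset $D\subsetneq F$ with $c(F)\in D$ belongs to $\mathrm{Ker}_s(\mathcal{G})$. $\mathbb{C}^{(k)}_\ell$ is the $k$-uniform linear cycle: $k$-sets $F_1,\dots,F_\ell$ and distinct vertices $v_1,\dots,v_\ell$ with $F_i\cap\{v_1,\dots,v_\ell\}=\{v_i,v_{i+1}\}$ (indices mod $\ell$) and the $F_i\setminus\{v_1,\dots,v_\ell\}$ pairwise disjoint.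 $\mathcal{C}^{(k)}_\ell$ is the family of $k$-uniform minimal cycles of length $\ell$: distinct $k$-sets $F_1,\dots,F_\ell$ and distinct vertices $v_1,\dots,v_\ell$ with $\{v_i,v_{i+1}\}\subseteq F_i$ (indices mod $\ell$) and $F_i\cap F_j=\emptyset$ for cyclically nonconsecutive $i,j$. -}

module Defs where

open import Data.Nat using (ℕ; zero; suc; _≤_; _*_; _∸_)
open import Data.Nat.DivMod using (_%_; m%n<n)
open import Data.Nat.Combinatorics using (_C_)
open import Data.Fin using (Fin; toℕ; fromℕ<)
open import Data.Fin.Subset using (Subset; _∩_; _⊂_; _⊆_; ∣_∣) renaming (_∈_ to _∈ₛ_; _∉_ to _∉ₛ_)
open import Data.List using (List; length; _++_)
open import Data.List.Membership.Propositional using (_∈_)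
open import Data.List.Relation.Unary.All using (All)
open import Data.List.Relation.Unary.Unique.Propositional using (Unique)
open import Data.List.Relation.Binary.Permutation.Propositional using (_↭_)
open import Data.Product using (Σ; ∃; ∃-syntax; _×_)
open import Data.Sum using (_⊎_)
open import Function.Definitions using (Injective)
open import Relation.Binary.PropositionalEquality using (_≡_; _≢_)

-- A family of subsets of [n] = Fin n, represented as a duplicate-free list.
Family : ℕ → Set
Family n = List (Subset n)

Uniform : ∀ {n} → ℕ → Family n → Set
Uniform k 𝓖 = All (λ A → ∣ A ∣ ≡ k) 𝓖

nxt : ∀ {ℓ} → Fin ℓ → Fin ℓ
nxt {suc m} i = fromℕ< (m%n<n (suc (toℕ i)) (suc m))

IsStar : ∀ {n} → Family n → Subset n → (t : ℕ) → (Fin t → Subset n) → Set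
IsStar 𝓖 D t G =
  (∀ i → G i ∈ 𝓖) ×
  (∀ i → D ⊂ G i) ×
  (∀ i j → i ≢ j → G i ∩ G j ≡ D)

-- D ∈ Ker_s(𝓖)  ⇔  deg*_𝓖(D) ≥ s, i.e. 𝓖 contains a t-star with kernel D
-- for some t ≥ s (deg* is the largest such t).
InKer : ∀ {n} → ℕ → Family n → Subset n → Set
InKer {n} s 𝓖 D = ∃[ t ] (s ≤ t × Σ (Fin t → Subset n) λ G → IsStar 𝓖 D t G)

Centralized : ∀ {n} → ℕ → Family n → Set
Centralized s 𝓖 =
  All (λ F → ∃[ c ] (c ∈ₛ F × (∀ D → D ⊂ F → c ∈ₛ D → InKer s 𝓖 D))) 𝓖

-- 𝓖 contains a copy of the k-uniform linear cycle ℂ^(k)_ℓ (as a subfamily):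
-- members F_1..F_ℓ and distinct vertices v_1..v_ℓ with
-- F_i ∩ {v_1..v_ℓ} = {v_i, v_{i+1}} and the sets F_i ∖ {v_1..v_ℓ} pairwise disjoint.
-- (The F_i are k-sets since they are members of the k-uniform 𝓖.)
ContainsLinearCycle : ∀ {n} → ℕ → Family n → Set
ContainsLinearCycle {n} ℓ 𝓖 =
  Σ (Fin ℓ → Subset n) λ F → Σ (Fin ℓ → Fin n) λ v →
    (∀ i → F i ∈ 𝓖) ×
    Injective _≡_ _≡_ v ×
    (∀ i x → (x ∈ₛ F i × (∃[ j ] v j ≡ x)) → (x ≡ v i ⊎ x ≡ v (nxt i))) ×
    (∀ i → v i ∈ₛ F i × v (nxt i) ∈ₛ F i) ×
    (∀ i j → i ≢ j → ∀ x → x ∈ₛ F i → x ∈ₛ F j → ∃[ m ] v m ≡ x)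

ContainsMinimalCycle : ∀ {n} → ℕ → Family n → Set
ContainsMinimalCycle {n} ℓ 𝓖 =
  Σ (Fin ℓ → Subset n) λ F → Σ (Fin ℓ → Fin n) λ v →
    (∀ i → F i ∈ 𝓖) ×
    Injective _≡_ _≡_ F ×
    Injective _≡_ _≡_ v ×
    (∀ i → v i ∈ₛ F i × v (nxt i) ∈ₛ F i) ×
    (∀ i j → i ≢ j → j ≢ nxt i → i ≢ nxt j → ∀ x → x ∈ₛ F i → x ∉ₛ F j)

{-# OPTIONS --safe #-}

-- Delta-system method. After passing to a k-partite subfamily, each member F has a trace F ↾ A for
-- every set A of colours. As long as a trace of type A is not the kernel of an s-star, all members
-- with this trace meet a bounded cover outside it, so sorting them by the covering vertex makes
-- traces of type A never occur as intersections. At the cost of a constant factor every type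
-- becomes either always a kernel (the types in P) or never an intersection, and P is then closed
-- under ∩. Let M be the set of colours a whose complement is not in P. If |M| ≤ 1, the family is
-- centralized. If the complement of some pair in M is not in P, members are determined by
-- their traces of that type, so there are at most n C (k ∸ 2) of them. Otherwise enough pairs of
-- colours are in P to build paths of any length between two vertices of one member, which closes
-- a forbidden cycle. Repeatedly removing centralized subfamilies therefore leaves a family of
-- size O(n C (k ∸ 2)).
module Submission where

open import Defs
open import Algebra.Properties.CommutativeSemigroup using (interchange)
open import Data.Bool.Properties using () renaming (_≟_ to _≟ᵇ_)
open import Data.Fin using (Fin; zero; suc; toℕ; fromℕ<)
open import Data.Fin.Properties using (any?; ¬∀⟶∃¬; injective⇒≤; toℕ-injective; toℕ<n; toℕ-fromℕ<) renaming (_≟_ to _≟ᶠ_)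
open import Data.Fin.Subset using (Subset; inside; outside; _∩_; _∪_; _-_; _⊂_; _⊆_; ∁; ⁅_⁆; ∣_∣) renaming (_∈_ to _∈ₛ_; _∉_ to _∉ₛ_; ⊤ to full)
open import Data.Fin.Subset.Properties using (_∈?_; ⊆-antisym; ∣p∣≤n; x∈p∩q⁺; x∈p∩q⁻; p─⊥≡p; _⊂?_; ∈⊤; p∩q⊆p; p∩q⊆q; x∈⁅x⁆; x∈⁅y⁆⇒x≡y; x∈p∪q⁺; x∈p∪q⁻; x∈∁p⇒x∉p; x∉p⇒x∈∁p; ∪-comm; p─q⊆p; x∈p∧x≢y⇒x∈p-y)
open import Data.List using (List; []; _∷_; length; _++_; filter; map; lookup; cartesianProduct; upTo; allFin)
open import Data.List.Membership.Propositional using (_∈_; _∉_; find; lose)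
open import Data.List.Membership.Propositional.Properties using (∈-filter⁺; ∈-filter⁻; ∈-map⁺; ∈-map⁻; ∈-++⁺ˡ; ∈-++⁺ʳ; ∈-lookup; ∈-cartesianProduct⁺; ∈-cartesianProduct⁻; ∈-allFin; ∈-upTo⁺)
open import Data.List.Membership.Setoid.Properties using (index-injective)
open import Data.List.Properties using (filter-all; filter-notAll; length-map; length-++; length-upTo; ++-assoc)
open import Data.List.Relation.Binary.Permutation.Propositional using (_↭_; ↭-refl; ↭-trans; prep; ↭-reflexive)
open import Data.List.Relation.Binary.Permutation.Propositional.Properties using (shift; ++⁺ˡ)
open import Data.List.Relation.Unary.All using (All; []; _∷_; tabulate) renaming (lookup to All-lookup; map to All-map)
open import Data.List.Relation.Unary.All.Properties using () renaming (++⁺ to All-++⁺)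
open import Data.List.Relation.Unary.AllPairs using ([]; _∷_)
open import Data.List.Relation.Unary.Any using (Any; here; there; index) renaming (any? to anyᴸ?)
open import Data.List.Relation.Unary.Any.Properties using (lookup-index)
open import Data.List.Relation.Unary.Unique.Propositional using (Unique)
open import Data.List.Relation.Unary.Unique.Propositional.Properties using (filter⁺)
open import Data.Maybe using (Maybe; just; nothing; maybe)
open import Data.Nat using (ℕ; zero; suc; _+_; _*_; _∸_; _^_; _≤_; _<_; z≤n; s≤s; z<s; _≟_; _≤?_)
open import Data.Nat.Combinatorics using (_C_; nCk+nC[k+1]≡[n+1]C[k+1]; k>n⇒nCk≡0; nCk≡nC[n∸k]; nCn≡1)
open import Data.Nat.DivMod using (_%_; m<n⇒m%n≡m; n%n≡0)
open import Data.Nat.ListAction using (sum)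
open import Data.Nat.Properties hiding (_≟_; _≤?_)
open import Data.Product using (Σ; ∃-syntax; _×_; _,_; proj₁; proj₂)
open import Data.Sum using (_⊎_; inj₁; inj₂; [_,_]′)
open import Data.Unit using (⊤; tt)
open import Data.Vec using ([]; _∷_; tail; here; there) renaming (tabulate to tabulateᵛ)
open import Data.Vec.Properties using (≡-dec; lookup∘tabulate; []=⇒lookup; lookup⇒[]=)
open import Function using (_∘_; id)
open import Relation.Binary using (DecidableEquality)
open import Relation.Binary.Definitions using (tri<; tri≈; tri>)
open import Relation.Binary.PropositionalEquality
open import Relation.Nullary using (¬_; Dec; yes; no; ¬?; contradiction; does)
open import Relation.Nullary.Decidable using (_×-dec_; dec-true; decidable-stable)
open import Relation.Unary using (Decidable)
import Data.Maybe.Properties as Maybe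
import Data.Product.Properties as Product

infix 4 _≟ₛ_
_≟ₛ_ : ∀ {n} → DecidableEquality (Subset n)
_≟ₛ_ = ≡-dec _≟ᵇ_

infix 4 _∈ᶠ?_
_∈ᶠ?_ : ∀ {n} (F : Subset n) (R : Family n) → Dec (F ∈ R)
_∈ᶠ?_ = _∈?ᴰ_
  where open import Data.List.Membership.DecPropositional _≟ₛ_ using () renaming (_∈?_ to _∈?ᴰ_)

-- Lists and counting

length-filter-∁ : ∀ {A : Set} {P : A → Set} (P? : Decidable P) xs →
  length (filter P? xs) + length (filter (¬? ∘ P?) xs) ≡ length xs
length-filter-∁ P? [] = refl
length-filter-∁ P? (x ∷ xs) with P? x
... | yes _ = cong suc (length-filter-∁ P? xs)
... | no _  = trans (+-suc _ _) (cong suc (length-filter-∁ P? xs))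

length-filter-filter : ∀ {A : Set} {P Q R : A → Set}
  (P? : Decidable P) (Q? : Decidable Q) (R? : Decidable R) →
  (∀ x → P x → Q x → R x) → ∀ xs →
  length (filter P? (filter Q? xs)) ≤ length (filter R? xs)
length-filter-filter P? Q? R? f [] = z≤n
length-filter-filter P? Q? R? f (x ∷ xs) with Q? x
length-filter-filter P? Q? R? f (x ∷ xs) | no _ with R? x
... | yes _ = m≤n⇒m≤1+n (length-filter-filter P? Q? R? f xs)
... | no _  = length-filter-filter P? Q? R? f xs
length-filter-filter P? Q? R? f (x ∷ xs) | yes q with P? x | R? x
... | yes p | yes _ = s≤s (length-filter-filter P? Q? R? f xs)
... | yes p | no ¬r = contradiction (f x p q) ¬r
... | no _  | yes _ = m≤n⇒m≤1+n (length-filter-filter P? Q? R? f xs)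
... | no _  | no _  = length-filter-filter P? Q? R? f xs

Unique⇒lookup-injective : ∀ {A : Set} {xs : List A} → Unique xs →
  ∀ {i j} → lookup xs i ≡ lookup xs j → i ≡ j
Unique⇒lookup-injective (_ ∷ _) {zero} {zero} _ = refl
Unique⇒lookup-injective (x∉ ∷ _) {zero} {suc j} eq = contradiction eq (All-lookup x∉ (∈-lookup j))
Unique⇒lookup-injective (x∉ ∷ _) {suc i} {zero} eq = contradiction (sym eq) (All-lookup x∉ (∈-lookup i))
Unique⇒lookup-injective (_ ∷ u) {suc i} {suc j} eq = cong suc (Unique⇒lookup-injective u eq)

injection-length : ∀ {A : Set} {m} (f : Fin m → A) (ys : List A) →
  (∀ {i j} → f i ≡ f j → i ≡ j) → (∀ i → f i ∈ ys) → m ≤ length ys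
injection-length f ys inj f∈ =
  injective⇒≤ {f = index ∘ f∈} λ {i} {j} eq → inj (index-injective (setoid _) (f∈ i) (f∈ j) eq)

unlisted : ∀ {k} (xs : List (Fin k)) → length xs < k → ∃[ x ] x ∉ xs
unlisted {k} xs lt = ¬∀⟶∃¬ k (_∈ xs) (_∈ᶜ? xs) λ all →
  <⇒≱ lt (injection-length id xs id all)
  where
  open import Data.List.Membership.DecPropositional _≟ᶠ_ using () renaming (_∈?_ to _∈ᶜ?_)

∈-∷⁻ : ∀ {A : Set} {x y : A} {xs} → x ∈ y ∷ xs → x ≢ y → x ∈ xs
∈-∷⁻ (here e) ne = contradiction e ne
∈-∷⁻ (there x∈) _ = x∈

-- Averaging over the labels, by induction on their list: the class of `l` competes with the best
-- class found among the elements not labelled `l`, and the larger of the two satisfies the bound.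
popular : ∀ {X L : Set} (_≟_ : DecidableEquality L) (g : X → L) l ls xs →
  (∀ {x} → x ∈ xs → g x ∈ l ∷ ls) →
  ∃[ l′ ] (l′ ∈ l ∷ ls × length xs ≤ suc (length ls) * length (filter (λ x → g x ≟ l′) xs))
popular _≟_ g l [] xs g∈ = l , here refl ,
  ≤-reflexive (trans (sym (cong length (filter-all (λ x → g x ≟ l) (tabulate λ x∈ → only (g∈ x∈))))) (sym (*-identityˡ _)))
  where
  only : ∀ {a} → a ∈ l ∷ [] → a ≡ l
  only (here e) = e
popular _≟_ g l (m ∷ ls) xs g∈
  with l′ , l′∈ , le ← popular _≟_ g m ls (filter (λ x → ¬? (g x ≟ l)) xs)
         (λ x∈ → let x∈xs , ne = ∈-filter⁻ (λ x → ¬? (g x ≟ l)) x∈ in ∈-∷⁻ (g∈ x∈xs) ne)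
  = pick (≤-total c′ c)
  where
  rest = filter (λ x → ¬? (g x ≟ l)) xs
  c  = length (filter (λ x → g x ≟ l) xs)
  c′ = length (filter (λ x → g x ≟ l′) xs)
  bound : length xs ≤ c + suc (length ls) * c′
  bound = begin
    length xs ≡⟨ length-filter-∁ (λ x → g x ≟ l) xs ⟨
    c + length rest ≤⟨ +-monoʳ-≤ c le ⟩
    c + suc (length ls) * length (filter (λ x → g x ≟ l′) rest)
      ≤⟨ +-monoʳ-≤ c (*-monoʳ-≤ (suc (length ls)) (length-filter-filter _ _ _ (λ _ p _ → p) xs)) ⟩
    c + suc (length ls) * c′ ∎
    where open ≤-Reasoning
  pick : c′ ≤ c ⊎ c ≤ c′ → _
  pick (inj₁ c′≤c) = l , here refl , ≤-trans bound (+-monoʳ-≤ c (*-monoʳ-≤ (suc (length ls)) c′≤c))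
  pick (inj₂ c≤c′) = l′ , there l′∈ , ≤-trans bound (+-monoˡ-≤ _ c≤c′)

-- Replaces a decision procedure for `Q`: every entry yields either `Q` or a counterexample with its
-- data in `B`, and a single counterexample settles the search.
search : ∀ {A : Set} {Q : A → Set} {B : Set} (xs : List A) →
  (∀ {x} → x ∈ xs → Q x ⊎ B) → (∀ {x} → x ∈ xs → Q x) ⊎ B
search [] f = inj₁ λ ()
search (x ∷ xs) f with f (here refl) | search xs (f ∘ there)
... | inj₂ b | _ = inj₂ b
... | inj₁ _ | inj₂ b = inj₂ b
... | inj₁ q | inj₁ qs = inj₁ λ { (here refl) → q ; (there x∈) → qs x∈ }

-- Finite sets

elements : ∀ {n} → Subset n → List (Fin n)
elements [] = []
elements (inside ∷ p) = zero ∷ map suc (elements p)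
elements (outside ∷ p) = map suc (elements p)

length-elements : ∀ {n} (p : Subset n) → length (elements p) ≡ ∣ p ∣
length-elements [] = refl
length-elements (inside ∷ p) = cong suc (trans (length-map suc (elements p)) (length-elements p))
length-elements (outside ∷ p) = trans (length-map suc (elements p)) (length-elements p)

∈-elements : ∀ {n} {x : Fin n} {p} → x ∈ₛ p → x ∈ elements p
∈-elements {p = inside ∷ p} here = here refl
∈-elements {p = inside ∷ p} (there x∈) = there (∈-map⁺ suc (∈-elements x∈))
∈-elements {p = outside ∷ p} (there x∈) = ∈-map⁺ suc (∈-elements x∈)

∣p∣≡1+∣p-x∣ : ∀ {n} {x : Fin n} {p} → x ∈ₛ p → ∣ p ∣ ≡ suc ∣ p - x ∣
∣p∣≡1+∣p-x∣ {p = inside ∷ p} here = cong (suc ∘ ∣_∣) (sym (p─⊥≡p p))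
∣p∣≡1+∣p-x∣ {p = inside ∷ p} (there x∈) = cong suc (∣p∣≡1+∣p-x∣ x∈)
∣p∣≡1+∣p-x∣ {p = outside ∷ p} (there x∈) = ∣p∣≡1+∣p-x∣ x∈

subsetsOfSize : ∀ n → ℕ → List (Subset n)
subsetsOfSize zero zero = [] ∷ []
subsetsOfSize zero (suc j) = []
subsetsOfSize (suc n) zero = map (outside ∷_) (subsetsOfSize n zero)
subsetsOfSize (suc n) (suc j) = map (inside ∷_) (subsetsOfSize n j) ++ map (outside ∷_) (subsetsOfSize n (suc j))

∈-subsetsOfSize : ∀ {n} (p : Subset n) → p ∈ subsetsOfSize n ∣ p ∣
∈-subsetsOfSize [] = here refl
∈-subsetsOfSize (inside ∷ p) = ∈-++⁺ˡ (∈-map⁺ (inside ∷_) (∈-subsetsOfSize p))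
∈-subsetsOfSize (outside ∷ p) with ∣ p ∣ | ∈-subsetsOfSize p
... | zero  | p∈ = ∈-map⁺ (outside ∷_) p∈
... | suc j | p∈ = ∈-++⁺ʳ _ (∈-map⁺ (outside ∷_) p∈)

length-subsetsOfSize : ∀ n j → length (subsetsOfSize n j) ≡ n C j
length-subsetsOfSize zero zero = refl
length-subsetsOfSize zero (suc j) = sym (k>n⇒nCk≡0 {n = 0} {k = suc j} z<s)
length-subsetsOfSize (suc n) zero =
  trans (length-map _ (subsetsOfSize n 0)) (trans (length-subsetsOfSize n 0) (nC0 n))
  where
  nC0 : ∀ n → n C 0 ≡ suc n C 0
  nC0 n = trans (trans (nCk≡nC[n∸k] {n = n} z≤n) (nCn≡1 n)) (sym (trans (nCk≡nC[n∸k] {n = suc n} z≤n) (nCn≡1 (suc n))))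
length-subsetsOfSize (suc n) (suc j) = begin
  length (map (inside ∷_) (subsetsOfSize n j) ++ map (outside ∷_) (subsetsOfSize n (suc j)))
    ≡⟨ length-++ (map (inside ∷_) (subsetsOfSize n j)) ⟩
  length (map (inside ∷_) (subsetsOfSize n j)) + length (map (outside ∷_) (subsetsOfSize n (suc j)))
    ≡⟨ cong₂ _+_ (trans (length-map _ (subsetsOfSize n j)) (length-subsetsOfSize n j))
                 (trans (length-map _ (subsetsOfSize n (suc j))) (length-subsetsOfSize n (suc j))) ⟩
  n C j + n C suc j ≡⟨ nCk+nC[k+1]≡[n+1]C[k+1] n j ⟩
  suc n C suc j ∎
  where open ≡-Reasoning

allSubsets : ∀ k → List (Subset k)
allSubsets zero = [] ∷ []
allSubsets (suc k) = map (inside ∷_) (allSubsets k) ++ map (outside ∷_) (allSubsets k)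

∈-allSubsets : ∀ {k} (p : Subset k) → p ∈ allSubsets k
∈-allSubsets [] = here refl
∈-allSubsets (inside ∷ p) = ∈-++⁺ˡ (∈-map⁺ (inside ∷_) (∈-allSubsets p))
∈-allSubsets (outside ∷ p) = ∈-++⁺ʳ _ (∈-map⁺ (outside ∷_) (∈-allSubsets p))

-- Rainbow colourings

∑ : ∀ {k} → (Fin k → ℕ) → ℕ
∑ {zero} f = 0
∑ {suc k} f = f zero + ∑ (f ∘ suc)

∑-0 : ∀ k → ∑ {k} (λ _ → 0) ≡ 0
∑-0 zero = refl
∑-0 (suc k) = ∑-0 k

∑-+ : ∀ {k} (f g : Fin k → ℕ) → ∑ (λ c → f c + g c) ≡ ∑ f + ∑ g
∑-+ {zero} f g = refl
∑-+ {suc k} f g = trans (cong (f zero + g zero +_) (∑-+ (f ∘ suc) (g ∘ suc)))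
  (interchange +-commutativeSemigroup (f zero) (g zero) (∑ (f ∘ suc)) (∑ (g ∘ suc)))

∑-mono : ∀ {k} {f g : Fin k → ℕ} → (∀ c → f c ≤ g c) → ∑ f ≤ ∑ g
∑-mono {zero} f≤g = z≤n
∑-mono {suc k} f≤g = +-mono-≤ (f≤g zero) (∑-mono (f≤g ∘ suc))

∑-const : ∀ k a → ∑ {k} (λ _ → a) ≡ k * a
∑-const zero a = refl
∑-const (suc k) a = cong (a +_) (∑-const k a)

term≤∑ : ∀ {k} (f : Fin k → ℕ) c → f c ≤ ∑ f
term≤∑ f zero = m≤m+n _ _
term≤∑ f (suc c) = ≤-trans (term≤∑ (f ∘ suc) c) (m≤n+m _ _)

∑-average : ∀ {k} (f : Fin (suc k) → ℕ) → ∃[ c ] ∑ f ≤ suc k * f c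
∑-average {zero} f = zero , ≤-refl
∑-average {suc k} f with c , le ← ∑-average (f ∘ suc) with ≤-total (f zero) (f (suc c))
... | inj₁ p = suc c , +-mono-≤ p le
... | inj₂ p = zero , +-monoʳ-≤ (f zero) (≤-trans le (*-monoʳ-≤ (suc k) p))

-- Proper r p χ: along the increasing enumeration of p, the colours are r, r+1, r+2, …
Proper : ∀ {n k} → ℕ → Subset n → (Fin n → Fin k) → Set
Proper r [] χ = ⊤
Proper r (inside ∷ p) χ = toℕ (χ zero) ≡ r × Proper (suc r) p (χ ∘ suc)
Proper r (outside ∷ p) χ = Proper r p (χ ∘ suc)

proper? : ∀ {n k} r (p : Subset n) (χ : Fin n → Fin k) → Dec (Proper r p χ)
proper? r [] χ = yes tt
proper? r (inside ∷ p) χ = (toℕ (χ zero) ≟ r) ×-dec proper? (suc r) p (χ ∘ suc)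
proper? r (outside ∷ p) χ = proper? r p (χ ∘ suc)

Proper-colour≥ : ∀ {n k r} {p : Subset n} {χ : Fin n → Fin k} → Proper r p χ → ∀ {x} → x ∈ₛ p → r ≤ toℕ (χ x)
Proper-colour≥ {p = inside ∷ p} (e , _) here = ≤-reflexive (sym e)
Proper-colour≥ {p = inside ∷ p} (_ , pr) (there x∈) = <⇒≤ (Proper-colour≥ {p = p} pr x∈)
Proper-colour≥ {p = outside ∷ p} pr (there x∈) = Proper-colour≥ {p = p} pr x∈

Proper-injective : ∀ {n k r} {p : Subset n} {χ : Fin n → Fin k} → Proper r p χ →
  ∀ {x y} → x ∈ₛ p → y ∈ₛ p → χ x ≡ χ y → x ≡ y
Proper-injective {p = inside ∷ p} _ here here _ = refl
Proper-injective {p = inside ∷ p} (refl , pr) here (there y∈) eq =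
  contradiction (≤-reflexive (cong toℕ (sym eq))) (<⇒≱ (Proper-colour≥ {p = p} pr y∈))
Proper-injective {p = inside ∷ p} (refl , pr) (there x∈) here eq =
  contradiction (≤-reflexive (cong toℕ eq)) (<⇒≱ (Proper-colour≥ {p = p} pr x∈))
Proper-injective {p = inside ∷ p} (_ , pr) (there x∈) (there y∈) eq =
  cong suc (Proper-injective {p = p} pr x∈ y∈ eq)
Proper-injective {p = outside ∷ p} pr (there x∈) (there y∈) eq =
  cong suc (Proper-injective {p = p} pr x∈ y∈ eq)

Proper-surjective : ∀ {n k r} {p : Subset n} {χ : Fin n → Fin k} → Proper r p χ →
  ∀ {a} → r ≤ a → a < r + ∣ p ∣ → ∃[ x ] (x ∈ₛ p × toℕ (χ x) ≡ a)
Proper-surjective {r = r} {p = []} pr r≤a a< = contradiction r≤a (<⇒≱ (subst (_ <_) (+-identityʳ r) a<))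
Proper-surjective {r = r} {p = outside ∷ p} pr r≤a a<
  with x , x∈ , e ← Proper-surjective {p = p} pr r≤a a< = suc x , there x∈ , e
Proper-surjective {r = r} {p = inside ∷ p} (e , pr) {a} r≤a a< with r ≟ a
... | yes refl = zero , here , e
... | no r≢a
  with x , x∈ , e′ ← Proper-surjective {p = p} pr (≤∧≢⇒< r≤a r≢a) (subst (a <_) (+-suc r ∣ p ∣) a<)
  = suc x , there x∈ , e′

sum-map-mono : ∀ {X : Set} {f g : X → ℕ} (xs : List X) → (∀ {x} → x ∈ xs → f x ≤ g x) →
  sum (map f xs) ≤ sum (map g xs)
sum-map-mono [] le = z≤n
sum-map-mono (x ∷ xs) le = +-mono-≤ (le (here refl)) (sum-map-mono xs (le ∘ there))

∑-sum-map : ∀ {X : Set} {k} (f : Fin k → X → ℕ) (xs : List X) →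
  ∑ (λ c → sum (map (f c) xs)) ≡ sum (map (λ x → ∑ (λ c → f c x)) xs)
∑-sum-map {k = k} f [] = ∑-0 k
∑-sum-map f (x ∷ xs) = trans (∑-+ (λ c → f c x) (λ c → sum (map (f c) xs))) (cong (_ +_) (∑-sum-map f xs))

weightIf : ∀ {P : Set} → Dec P → ℕ → ℕ
weightIf (yes _) a = a
weightIf (no _) a = 0

weightIf-yes : ∀ {P : Set} (d : Dec P) {a} → P → a ≤ weightIf d a
weightIf-yes (yes _) p = ≤-refl
weightIf-yes (no ¬p) p = contradiction p ¬p

sum-map-filter : ∀ {X : Set} {P : X → Set} (P? : Decidable P) (w : X → ℕ) xs →
  sum (map w (filter P? xs)) ≡ sum (map (λ x → weightIf (P? x) (w x)) xs)
sum-map-filter P? w [] = refl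
sum-map-filter P? w (x ∷ xs) with P? x
... | yes _ = cong (w x +_) (sum-map-filter P? w xs)
... | no _ = sum-map-filter P? w xs

-- The condition that `Proper r p` puts on the colour of vertex `zero` alone; it lets colours be
-- fixed one vertex at a time.
HeadProper : ∀ {n k} → Subset (suc n) → ℕ → Fin k → Set
HeadProper (inside ∷ p) r c = toℕ c ≡ r
HeadProper (outside ∷ p) r c = ⊤

headProper? : ∀ {n k} (p : Subset (suc n)) r (c : Fin k) → Dec (HeadProper p r c)
headProper? (inside ∷ p) r c = toℕ c ≟ r
headProper? (outside ∷ p) r c = yes tt

nextColour : ∀ {n} → Subset (suc n) → ℕ → ℕ
nextColour (inside ∷ p) r = suc r
nextColour (outside ∷ p) r = r

_◂_ : ∀ {n} {A : Set} → A → (Fin n → A) → Fin (suc n) → A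
(c ◂ χ) zero = c
(c ◂ χ) (suc x) = χ x

Proper-∷ : ∀ {n k} (p : Subset (suc n)) r {c : Fin k} {χ} →
  Proper (nextColour p r) (tail p) χ → HeadProper p r c → Proper r p (c ◂ χ)
Proper-∷ (inside ∷ p) r pr h = h , pr
Proper-∷ (outside ∷ p) r pr h = pr

-- The method of conditional expectations: the weight (1+k)^(n - |p|) is (1+k)^n times the
-- probability that a uniformly random colouring is proper on p.
many-proper : ∀ {X : Set} n k (xs : List X) (r : X → ℕ) (p : X → Subset n) →
  (∀ {x} → x ∈ xs → r x + ∣ p x ∣ ≤ suc k) →
  ∃[ χ ] sum (map (λ x → suc k ^ (n ∸ ∣ p x ∣)) xs) ≤
         suc k ^ n * length (filter (λ x → proper? {k = suc k} (r x) (p x) χ) xs)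
many-proper zero k xs r p _ = (λ ()) , (begin
  sum (map (λ x → suc k ^ (0 ∸ ∣ p x ∣)) xs) ≤⟨ sum-map-mono xs (λ {x} _ → ≤-reflexive (cong (suc k ^_) (0∸n≡0 ∣ p x ∣))) ⟩
  sum (map (λ _ → 1) xs) ≡⟨ sum-1 xs ⟩
  length xs ≡⟨ cong length (filter-all _ (tabulate {xs = xs} λ {x} _ → nil (p x))) ⟨
  length (filter (λ x → proper? (r x) (p x) (λ ())) xs) ≡⟨ *-identityˡ _ ⟨
  1 * length (filter (λ x → proper? (r x) (p x) (λ ())) xs) ∎)
  where
  open ≤-Reasoning
  sum-1 : ∀ {X : Set} (xs : List X) → sum (map (λ _ → 1) xs) ≡ length xs
  sum-1 [] = refl
  sum-1 (_ ∷ xs) = cong suc (sum-1 xs)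
  nil : ∀ {r} {χ : Fin 0 → Fin (suc k)} (q : Subset 0) → Proper r q χ
  nil [] = tt
many-proper {X} (suc n) k xs r p ok = c ◂ proj₁ ih , (begin
  sum (map (λ x → K ^ (suc n ∸ ∣ p x ∣)) xs) ≤⟨ sum-map-mono xs (λ x∈ → split (r _) (p _) (ok x∈)) ⟩
  sum (map (λ x → ∑ (λ c → weightIf (keep? c x) (w x))) xs) ≡⟨ ∑-sum-map (λ c x → weightIf (keep? c x) (w x)) xs ⟨
  ∑ (λ c → sum (map (λ x → weightIf (keep? c x) (w x)) xs)) ≤⟨ proj₂ avg ⟩
  K * sum (map (λ x → weightIf (keep? c x) (w x)) xs) ≡⟨ cong (K *_) (sum-map-filter (keep? c) w xs) ⟨
  K * sum (map w (filter (keep? c) xs)) ≤⟨ *-monoʳ-≤ K (proj₂ ih) ⟩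
  K * (K ^ n * length (filter good′? (filter (keep? c) xs)))
    ≤⟨ *-monoʳ-≤ K (*-monoʳ-≤ (K ^ n) (length-filter-filter good′? (keep? c) good? (λ x → Proper-∷ (p x) (r x)) xs)) ⟩
  K * (K ^ n * length (filter good? xs)) ≡⟨ *-assoc K (K ^ n) _ ⟨
  K ^ suc n * length (filter good? xs) ∎)
  where
  open ≤-Reasoning
  K = suc k
  keep? : ∀ (c : Fin K) x → Dec (HeadProper (p x) (r x) c)
  keep? c x = headProper? (p x) (r x) c
  w : X → ℕ
  w x = K ^ (n ∸ ∣ tail (p x) ∣)
  -- The first vertex gets a colour for which the total weight of the sets still alive is at least
  -- the average over all colours.
  avg = ∑-average (λ c → sum (map (λ x → weightIf (keep? c x) (w x)) xs))
  c = proj₁ avg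
  next-ok : ∀ r (q : Subset (suc n)) → r + ∣ q ∣ ≤ K → nextColour q r + ∣ tail q ∣ ≤ K
  next-ok r (inside ∷ q) le = subst (_≤ K) (+-suc r ∣ q ∣) le
  next-ok r (outside ∷ q) le = le
  ih = many-proper n k (filter (keep? c) xs) (λ x → nextColour (p x) (r x)) (tail ∘ p)
         (λ x∈ → next-ok (r _) (p _) (ok (proj₁ (∈-filter⁻ (keep? c) x∈))))
  good′? = λ x → proper? (nextColour (p x) (r x)) (tail (p x)) (proj₁ ih)
  good? = λ x → proper? (r x) (p x) (c ◂ proj₁ ih)
  -- If `zero` lies outside `q`, all `K` colours keep `q` alive, each with one factor `K` less. If
  -- it lies inside, the colour `r` alone carries the whole weight, since `n` and the size of `q`
  -- both drop by one.
  split : ∀ r (q : Subset (suc n)) → r + ∣ q ∣ ≤ K →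
    K ^ (suc n ∸ ∣ q ∣) ≤ ∑ {K} (λ c → weightIf (headProper? q r c) (K ^ (n ∸ ∣ tail q ∣)))
  split r (outside ∷ q) _ = ≤-reflexive (trans (cong (K ^_) (+-∸-assoc 1 (∣p∣≤n q))) (sym (∑-const K (K ^ (n ∸ ∣ q ∣)))))
  split r (inside ∷ q) le = ≤-trans
    (weightIf-yes (toℕ c₀ ≟ r) (toℕ-fromℕ< r<K))
    (term≤∑ (λ c → weightIf (toℕ c ≟ r) (K ^ (n ∸ ∣ q ∣))) c₀)
    where
    r<K : r < K
    r<K = ≤-trans (s≤s (m≤m+n r ∣ q ∣)) (subst (_≤ K) (+-suc r ∣ q ∣) le)
    c₀ = fromℕ< r<K

module Colouring {n k : ℕ} (χ : Fin n → Fin k) where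

  record Rainbow (F : Subset n) : Set where
    field
      size   : ∣ F ∣ ≡ k
      vertex : ∀ a → ∃[ x ] (x ∈ₛ F × χ x ≡ a)
      unique : ∀ {x y} → x ∈ₛ F → y ∈ₛ F → χ x ≡ χ y → x ≡ y

-- It suffices to count members whose vertices receive the colours 0, 1, 2, ... in increasing order:
-- such members are rainbow, and the reciprocal of `suc k ^ suc k` is the probability that a random
-- colouring does this to a given member.
many-rainbow : ∀ {n} k (𝓕 : Family n) → Uniform (suc k) 𝓕 →
  ∃[ χ ] Σ (∀ F → Dec (Proper 0 F χ)) λ P? →
    All (Colouring.Rainbow {k = suc k} χ) (filter P? 𝓕) ×
    length 𝓕 ≤ suc k ^ suc k * length (filter P? 𝓕)
-- The empty family is treated apart because the computation below needs `K ≤ n`, which is read off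
-- from a member.
many-rainbow k [] _ = (λ _ → zero) , (λ F → proper? 0 F _) , [] , z≤n
many-rainbow {n} k 𝓕@(F₀ ∷ _) unif@(e₀ ∷ _) = χ , P? , tabulate (λ F∈ → rainbow (∈-filter⁻ P? F∈)) ,
  *-cancelˡ-≤ (K ^ (n ∸ K)) ⦃ m^n≢0 K (n ∸ K) ⦄ (begin
    K ^ (n ∸ K) * length 𝓕 ≡⟨ sum-const 𝓕 ⟨
    sum (map (λ _ → K ^ (n ∸ K)) 𝓕) ≤⟨ sum-map-mono 𝓕 (λ F∈ → ≤-reflexive (cong (λ j → K ^ (n ∸ j)) (sym (All-lookup unif F∈)))) ⟩
    sum (map (λ F → K ^ (n ∸ ∣ F ∣)) 𝓕) ≤⟨ proj₂ mp ⟩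
    K ^ n * good ≡⟨ cong (λ j → K ^ j * good) (m∸n+n≡m K≤n) ⟨
    K ^ (n ∸ K + K) * good ≡⟨ cong (_* good) (^-distribˡ-+-* K (n ∸ K) K) ⟩
    K ^ (n ∸ K) * K ^ K * good ≡⟨ *-assoc (K ^ (n ∸ K)) (K ^ K) good ⟩
    K ^ (n ∸ K) * (K ^ K * good) ∎)
  where
  open ≤-Reasoning
  K = suc k
  mp = many-proper n k 𝓕 (λ _ → 0) id (λ F∈ → ≤-reflexive (All-lookup unif F∈))
  χ = proj₁ mp
  P? : ∀ F → Dec (Proper 0 F χ)
  P? F = proper? 0 F χ
  good = length (filter P? 𝓕)
  K≤n : K ≤ n
  K≤n = subst (_≤ n) e₀ (∣p∣≤n F₀)
  sum-const : ∀ (xs : Family n) → sum (map (λ _ → K ^ (n ∸ K)) xs) ≡ K ^ (n ∸ K) * length xs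
  sum-const [] = sym (*-zeroʳ (K ^ (n ∸ K)))
  sum-const (_ ∷ xs) = trans (cong (K ^ (n ∸ K) +_) (sum-const xs)) (sym (*-suc (K ^ (n ∸ K)) (length xs)))
  rainbow : ∀ {F} → F ∈ 𝓕 × Proper 0 F χ → Colouring.Rainbow χ F
  rainbow {F} (F∈ , pr) = record
    { size = All-lookup unif F∈
    ; vertex = λ a → let x , x∈ , e = Proper-surjective {p = F} pr z≤n (subst (toℕ a <_) (sym (All-lookup unif F∈)) (toℕ<n a))
                     in x , x∈ , toℕ-injective e
    ; unique = Proper-injective {p = F} pr }

length-cartesianProduct : ∀ {A B : Set} (xs : List A) (ys : List B) →
  length (cartesianProduct xs ys) ≡ length xs * length ys
length-cartesianProduct [] ys = refl
length-cartesianProduct (x ∷ xs) ys = trans (length-++ (map (x ,_) ys))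
  (cong₂ _+_ (length-map (x ,_) ys) (length-cartesianProduct xs ys))

-- Subsets given by decidable predicates

⟪_⟫ : ∀ {n} {P : Fin n → Set} → Decidable P → Subset n
⟪ P? ⟫ = tabulateᵛ (does ∘ P?)

∈⟪⟫⁺ : ∀ {n} {P : Fin n → Set} (P? : Decidable P) {x} → P x → x ∈ₛ ⟪ P? ⟫
∈⟪⟫⁺ P? {x} p = lookup⇒[]= x _ (trans (lookup∘tabulate _ x) (dec-true (P? x) p))

∈⟪⟫⁻ : ∀ {n} {P : Fin n → Set} (P? : Decidable P) {x} → x ∈ₛ ⟪ P? ⟫ → P x
∈⟪⟫⁻ P? {x} x∈ with P? x | trans (sym (lookup∘tabulate (does ∘ P?) x)) ([]=⇒lookup x∈)
... | yes p | _ = p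
... | no _ | ()

∃∉ : ∀ {k} {A : Subset k} → A ≢ full → ∃[ a ] a ∉ₛ A
∃∉ {k} {A} A≢ = ¬∀⟶∃¬ k (_∈ₛ A) (_∈? A) λ all → A≢ (⊆-antisym {i = A} {j = full} (λ _ → ∈⊤) (λ {x} _ → all x))

-- Stars and kernels


Hit : ∀ {n} → Subset n → Subset n → Fin n → Set
Hit D G x = x ∈ₛ G × x ∉ₛ D

hit? : ∀ {n} (D G : Subset n) → Decidable (Hit D G)
hit? D G x = (x ∈? G) ×-dec ¬? (x ∈? D)

InKer-mono : ∀ {n s} {𝓖 𝓗 : Family n} {D} → (∀ {G} → G ∈ 𝓖 → G ∈ 𝓗) → InKer s 𝓖 D → InKer s 𝓗 D
InKer-mono sub (t , s≤t , G , G∈ , rest) = t , s≤t , G , sub ∘ G∈ , rest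

-- A member properly containing `D` joins the star unless it meets the vertex list `W` of the star
-- outside `D`. So whether it joins or not, `W` finally hits it outside `D`.
greedy-star : ∀ {n} k (𝓖 : Family n) D → Uniform k 𝓖 →
  ∃[ t ] Σ (Fin t → Subset n) λ G → IsStar 𝓖 D t G ×
  ∃[ W ] (length W ≤ t * k × (∀ i {x} → x ∈ₛ G i → x ∈ W) ×
          (∀ {F} → F ∈ 𝓖 → D ⊂ F → Any (Hit D F) W))
greedy-star k [] D _ = 0 , (λ ()) , ((λ ()) , (λ ()) , (λ ())) , [] , z≤n , (λ ()) , (λ ())
greedy-star k (F ∷ 𝓖) D (size ∷ unif)
  with t , G , (G∈ , D⊂G , G∩G) , W , W≤ , G⊆W , hits ← greedy-star k 𝓖 D unif
  with D ⊂? F | anyᴸ? (hit? D F) W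
... | no D⊄F | _ = t , G , (there ∘ G∈ , D⊂G , G∩G) , W , W≤ , G⊆W ,
  λ { (here refl) D⊂F → contradiction D⊂F D⊄F ; (there F∈) → hits F∈ }
... | yes _ | yes h = t , G , (there ∘ G∈ , D⊂G , G∩G) , W , W≤ , G⊆W ,
  λ { (here refl) _ → h ; (there F∈) → hits F∈ }
... | yes D⊂F@(D⊆F , x₀ , x₀∈F , x₀∉D) | no ¬h =
  suc t , F ◂ G , (mem , strict , meet) , elements F ++ W ,
  subst (_≤ k + t * k) (sym (length-++ (elements F))) (+-mono-≤ (≤-reflexive (trans (length-elements F) size)) W≤) ,
  (λ { zero x∈ → ∈-++⁺ˡ (∈-elements x∈) ; (suc i) x∈ → ∈-++⁺ʳ (elements F) (G⊆W i x∈) }) ,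
  λ { (here refl) _ → lose (∈-++⁺ˡ (∈-elements x₀∈F)) (x₀∈F , x₀∉D)
    ; (there F∈) D⊂ → let x , x∈W , h = find (hits F∈ D⊂) in lose (∈-++⁺ʳ (elements F) x∈W) h }
  where
  mem : ∀ i → (F ◂ G) i ∈ F ∷ 𝓖
  mem zero = here refl
  mem (suc i) = there (G∈ i)
  strict : ∀ i → D ⊂ (F ◂ G) i
  strict zero = D⊂F
  strict (suc i) = D⊂G i
  F∩G⊆D : ∀ i {x} → x ∈ₛ F → x ∈ₛ G i → x ∈ₛ D
  F∩G⊆D i {x} x∈F x∈G = decidable-stable (x ∈? D) λ x∉D → ¬h (lose (G⊆W i x∈G) (x∈F , x∉D))
  meet : ∀ i j → i ≢ j → (F ◂ G) i ∩ (F ◂ G) j ≡ D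
  meet zero zero i≢j = contradiction refl i≢j
  meet zero (suc j) _ = ⊆-antisym
    (λ x∈ → let x∈F , x∈G = x∈p∩q⁻ F (G j) x∈ in F∩G⊆D j x∈F x∈G)
    (λ x∈ → x∈p∩q⁺ (D⊆F x∈ , proj₁ (D⊂G j) x∈))
  meet (suc i) zero _ = ⊆-antisym
    (λ x∈ → let x∈G , x∈F = x∈p∩q⁻ (G i) F x∈ in F∩G⊆D i x∈F x∈G)
    (λ x∈ → x∈p∩q⁺ (proj₁ (D⊂G i) x∈ , D⊆F x∈))
  meet (suc i) (suc j) i≢j = G∩G i j (i≢j ∘ cong suc)

kernel-or-cover : ∀ {n} k s (𝓖 : Family n) D → Uniform k 𝓖 →
  InKer s 𝓖 D ⊎ ∃[ W ] (length W ≤ s * k × (∀ {F} → F ∈ 𝓖 → D ⊂ F → Any (Hit D F) W))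
kernel-or-cover k s 𝓖 D unif
  with t , G , star , W , W≤ , _ , hits ← greedy-star k 𝓖 D unif with s ≤? t
... | yes s≤t = inj₁ (t , s≤t , G , star)
... | no s≰t = inj₂ (W , ≤-trans W≤ (*-monoˡ-≤ k (<⇒≤ (≰⇒> s≰t))) , hits)

-- The petals of a star are pairwise disjoint outside `D`, so each vertex of `W` outside `D` spoils
-- at most one of them, and fewer than `s` vertices leave some petal untouched.
avoiding-member : ∀ {n s} {𝓖 : Family n} {D} → InKer s 𝓖 D → (W : List (Fin n)) → length W < s →
  ∃[ F ] (F ∈ 𝓖 × D ⊆ F × (∀ {x} → x ∈ₛ F → x ∈ W → x ∈ₛ D))
avoiding-member {D = D} (t , s≤t , G , G∈ , D⊂G , G∩G) W W<s =
  let i , ¬h = ¬∀⟶∃¬ t (λ i → Any (Hit D (G i)) W) (λ i → anyᴸ? (hit? D (G i)) W) ¬all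
  in G i , G∈ i , proj₁ (D⊂G i) ,
     λ {x} x∈G x∈W → decidable-stable (x ∈? D) λ x∉D → ¬h (lose x∈W (x∈G , x∉D))
  where
  ¬all : ¬ (∀ i → Any (Hit D (G i)) W)
  ¬all h = <⇒≱ (≤-trans W<s s≤t) (injection-length w W w-injective (λ i → proj₁ (proj₂ (find (h i)))))
    where
    w : Fin t → _
    w i = proj₁ (find (h i))
    w-hit : ∀ i → Hit D (G i) (w i)
    w-hit i = proj₂ (proj₂ (find (h i)))
    w-injective : ∀ {i j} → w i ≡ w j → i ≡ j
    w-injective {i} {j} eq = decidable-stable (i ≟ᶠ j) λ i≢j →
      proj₂ (w-hit i) (subst (w i ∈ₛ_) (G∩G i j i≢j)
        (x∈p∩q⁺ (proj₁ (w-hit i) , subst (_∈ₛ G j) (sym eq) (proj₁ (w-hit j)))))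

-- The position in W of the first vertex of G outside D (0 if there is none).
hitIndex : ∀ {n} → List (Fin n) → Subset n → Subset n → ℕ
hitIndex W D G with anyᴸ? (hit? D G) W
... | yes h = toℕ (index h)
... | no _ = 0

hitIndex< : ∀ {n} W (D G : Subset n) → Any (Hit D G) W → hitIndex W D G < length W
hitIndex< W D G h with anyᴸ? (hit? D G) W
... | yes h′ = toℕ<n (index h′)
... | no ¬h = contradiction h ¬h

hitIndex-common : ∀ {n} W (D F G : Subset n) → Any (Hit D F) W → Any (Hit D G) W →
  hitIndex W D F ≡ hitIndex W D G → ∃[ x ] (x ∈ₛ F × x ∈ₛ G × x ∉ₛ D)
hitIndex-common W D F G hF hG eq with anyᴸ? (hit? D F) W | anyᴸ? (hit? D G) W
... | no ¬h | _ = contradiction hF ¬h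
... | yes _ | no ¬h = contradiction hG ¬h
... | yes f | yes g = lookup W (index f) , proj₁ (lookup-index f) ,
  subst (λ i → lookup W i ∈ₛ G) (sym (toℕ-injective eq)) (proj₁ (lookup-index g)) , proj₂ (lookup-index f)

-- Types, traces and cleaning

cleaningConstant : ℕ → ℕ → ℕ → ℕ
cleaningConstant k s zero = 1
-- One factor per cleaned type: with `suc p` types left, a label is `nothing` or a type together
-- with one of `s * k` positions in a cover.
cleaningConstant k s (suc p) = suc (suc p * (s * k)) * cleaningConstant k s p

cleaningConstant≥1 : ∀ k s p → 1 ≤ cleaningConstant k s p
cleaningConstant≥1 k s zero = ≤-refl
cleaningConstant≥1 k s (suc p) =
  *-mono-≤ {x = 1} {y = suc (suc p * (s * k))} {u = 1} (s≤s z≤n) (cleaningConstant≥1 k s p)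

module Types {n k : ℕ} (χ : Fin n → Fin k) where
  open Colouring χ public
  open Rainbow

  infix 8 _↾_
  _↾_ : Subset n → Subset k → Subset n
  F ↾ A = ⟪ (λ x → (x ∈? F) ×-dec (χ x ∈? A)) ⟫

  ∈↾⁺ : ∀ {F A x} → x ∈ₛ F → χ x ∈ₛ A → x ∈ₛ F ↾ A
  ∈↾⁺ {F} {A} x∈ c∈ = ∈⟪⟫⁺ (λ x → (x ∈? F) ×-dec (χ x ∈? A)) (x∈ , c∈)

  ∈↾⁻ : ∀ {F A x} → x ∈ₛ F ↾ A → x ∈ₛ F × χ x ∈ₛ A
  ∈↾⁻ {F} {A} = ∈⟪⟫⁻ (λ x → (x ∈? F) ×-dec (χ x ∈? A))

  hasColour? : ∀ D → Decidable (λ a → ∃[ x ] (x ∈ₛ D × χ x ≡ a))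
  hasColour? D a = any? (λ x → (x ∈? D) ×-dec (χ x ≟ᶠ a))

  colours : Subset n → Subset k
  colours D = ⟪ hasColour? D ⟫

  ↾-colours : ∀ {F D} → Rainbow F → D ⊆ F → D ≡ F ↾ colours D
  ↾-colours {F} {D} rF D⊆F = ⊆-antisym
    (λ x∈ → ∈↾⁺ (D⊆F x∈) (∈⟪⟫⁺ (hasColour? D) (_ , x∈ , refl)))
    (λ x∈ → let x∈F , c∈ = ∈↾⁻ {F} {colours D} x∈
                y , y∈D , e = ∈⟪⟫⁻ (hasColour? D) c∈
            in subst (_∈ₛ D) (unique rF (D⊆F y∈D) x∈F e) y∈D)

  -- A rainbow `G` has only one vertex of each colour, and those with colours in `A` are already
  -- supplied by `F ↾ A`.
  ↾-⊆ : ∀ {F G A} → Rainbow F → Rainbow G → F ↾ A ⊆ G → G ↾ A ≡ F ↾ A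
  ↾-⊆ {F} {G} {A} rF rG sub = ⊆-antisym
    (λ x∈ → let x∈G , c∈ = ∈↾⁻ {G} {A} x∈
                y , y∈F , e = vertex rF (χ _)
                y∈ = ∈↾⁺ {F} {A} y∈F (subst (_∈ₛ A) (sym e) c∈)
            in subst (_∈ₛ F ↾ A) (unique rG (sub y∈) x∈G e) y∈)
    (λ x∈ → ∈↾⁺ (sub x∈) (proj₂ (∈↾⁻ {F} {A} x∈)))

  ↾-⊂ : ∀ {F A} → Rainbow F → A ≢ full → F ↾ A ⊂ F
  ↾-⊂ {F} {A} rF A≢ =
    let a , a∉ = ∃∉ A≢
        x , x∈ , e = vertex rF a
    in (λ y∈ → proj₁ (∈↾⁻ {F} {A} y∈)) , x , x∈ , λ x∈↾ → a∉ (subst (_∈ₛ A) e (proj₂ (∈↾⁻ {F} {A} x∈↾)))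

  Clean : Family n → Subset k → Set
  Clean R A = ∀ {F G} → F ∈ R → G ∈ R → F ∩ G ≢ F ↾ A

  record Homogeneous (s : ℕ) (R : Family n) (P : List (Subset k)) : Set where
    field
      proper  : ∀ {A} → A ∈ P → A ≢ full
      kernels : ∀ {A F} → A ∈ P → F ∈ R → InKer s R (F ↾ A)
      clean   : ∀ {A} → A ≢ full → A ∉ P → Clean R A

  -- `nothing` marks the survivors, all of whose traces with types in `P` are kernels;
  -- `just (A , w)` marks a member discarded because of type `A`, with `w` a position in the cover.
  Label : Set
  Label = Maybe (Subset k × ℕ)

  _≟ᴸ_ : DecidableEquality Label
  _≟ᴸ_ = Maybe.≡-dec (Product.≡-dec _≟ₛ_ _≟_)

  module Cleaning (s : ℕ) (P : List (Subset k)) (P-proper : ∀ {A} → A ∈ P → A ≢ full) where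

    pairs : List Label
    pairs = map just (cartesianProduct P (upTo (s * k)))

    class? : (g : Subset n → Label) (l : Label) → Decidable (λ F → g F ≡ l)
    class? g l F = g F ≟ᴸ l

    record Labelling (R : Family n) : Set where
      field
        label   : Subset n → Label
        label∈  : ∀ {F} → F ∈ R → label F ∈ nothing ∷ pairs
        cleans  : ∀ {A w F G} → F ∈ R → G ∈ R → label F ≡ just (A , w) → label G ≡ just (A , w) → F ∩ G ≢ F ↾ A
        -- The stars must lie in the surviving class itself, so that this class can become the
        -- homogeneous family.
        kernels : ∀ {A F} → A ∈ P → F ∈ R → label F ≡ nothing → InKer s (filter (class? label nothing) R) (F ↾ A)
    open Labelling

    -- A member whose trace D of type A is not a kernel leaves the family together with all
    -- members having the same trace; they are labelled by A and a vertex of the cover of D.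
    labelling : ∀ N R → length R ≤ N → All Rainbow R → Labelling R
    labelling zero [] _ _ = record
      { label = λ _ → nothing ; label∈ = λ () ; cleans = λ () ; kernels = λ _ () }
    labelling (suc N) R R≤ rR
      with search P (λ {A} A∈ → search {Q = λ F → InKer s R (F ↾ A)}
             {B = ∃[ A ] ∃[ F ] (A ∈ P × F ∈ R × ∃[ W ] (length W ≤ s * k × (∀ {G} → G ∈ R → F ↾ A ⊂ G → Any (Hit (F ↾ A) G) W)))}
             R (λ {F} F∈ → [ inj₁ , (λ cov → inj₂ (A , F , A∈ , F∈ , cov)) ]′
                 (kernel-or-cover k s R (F ↾ A) (All-map size rR))))
    ... | inj₁ ker = record
      { label = λ _ → nothing
      ; label∈ = λ _ → here refl
      ; cleans = λ _ _ ()
      ; kernels = λ A∈ F∈ _ → InKer-mono (λ G∈ → ∈-filter⁺ (class? (λ _ → nothing) nothing) G∈ refl) (ker A∈ F∈) }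
    ... | inj₂ (A , F₀ , A∈ , F₀∈ , W , W≤ , hits) = record
      { label = g ; label∈ = g∈ ; cleans = g-cleans ; kernels = g-kernels }
      where
      D = F₀ ↾ A
      rest? : Decidable (λ G → G ↾ A ≢ D)
      rest? G = ¬? (G ↾ A ≟ₛ D)
      rest = filter rest? R
      rb : ∀ {G} → G ∈ R → Rainbow G
      rb = All-lookup rR
      ih : Labelling rest
      ih = labelling N rest
        (≤-pred (≤-trans (filter-notAll rest? R (lose F₀∈ (λ ¬e → ¬e refl))) R≤))
        (tabulate λ G∈ → rb (proj₁ (∈-filter⁻ rest? G∈)))
      hit : ∀ {G} → G ∈ R → G ↾ A ≡ D → Any (Hit D G) W
      hit {G} G∈ e = hits G∈ (subst (_⊂ G) e (↾-⊂ (rb G∈) (P-proper A∈)))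
      g : Subset n → Label
      g G with G ↾ A ≟ₛ D
      ... | yes _ = just (A , hitIndex W D G)
      ... | no _ = label ih G
      g∈ : ∀ {G} → G ∈ R → g G ∈ nothing ∷ pairs
      g∈ {G} G∈ with G ↾ A ≟ₛ D
      ... | yes e = there (∈-map⁺ just (∈-cartesianProduct⁺ A∈ (∈-upTo⁺ (≤-trans (hitIndex< W D G (hit G∈ e)) W≤))))
      ... | no ne = label∈ ih (∈-filter⁺ rest? G∈ ne)
      trace : ∀ {B F G} → F ∈ R → G ∈ R → F ∩ G ≡ F ↾ B → G ↾ B ≡ F ↾ B
      trace {B} {F} {G} F∈ G∈ e = ↾-⊆ {A = B} (rb F∈) (rb G∈) λ x∈ → p∩q⊆q F G (subst (_ ∈ₛ_) (sym e) x∈)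
      g-cleans : ∀ {B w F G} → F ∈ R → G ∈ R → g F ≡ just (B , w) → g G ≡ just (B , w) → F ∩ G ≢ F ↾ B
      g-cleans {B} {w} {F} {G} F∈ G∈ gF gG e with F ↾ A ≟ₛ D | G ↾ A ≟ₛ D
      -- Equal positions give a vertex common to `F` and `G` outside `D`, although `F ∩ G` would be
      -- `D`.
      g-cleans {B} {w} {F} {G} F∈ G∈ refl gG e | yes eF | yes eG =
        let x , x∈F , x∈G , x∉D = hitIndex-common W D F G (hit F∈ eF) (hit G∈ eG)
                                    (sym (cong (maybe proj₂ 0) gG))
        in x∉D (subst (x ∈ₛ_) (trans e eF) (x∈p∩q⁺ (x∈F , x∈G)))
      -- An intersection equal to the trace of type `A` forces equal traces of that type, so it
      -- cannot happen that exactly one of `F` and `G` has the trace `D`. The next case is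
      -- symmetric.
      g-cleans F∈ G∈ refl gG e | yes eF | no nG = nG (trans (trace F∈ G∈ e) eF)
      g-cleans F∈ G∈ gF refl e | no nF | yes eG = nF (trans (sym (trace F∈ G∈ e)) eG)
      g-cleans F∈ G∈ gF gG e | no nF | no nG =
        cleans ih (∈-filter⁺ rest? F∈ nF) (∈-filter⁺ rest? G∈ nG) gF gG e
      final : ∀ {G} → G ∈ filter (class? (label ih) nothing) rest → G ∈ filter (class? g nothing) R
      final {G} G∈ =
        let G∈rest , e = ∈-filter⁻ (class? (label ih) nothing) {xs = rest} G∈
            G∈R , ne = ∈-filter⁻ rest? {xs = R} G∈rest
        in ∈-filter⁺ (class? g nothing) G∈R (g≡ ne e)
        where
        g≡ : G ↾ A ≢ D → label ih G ≡ nothing → g G ≡ nothing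
        g≡ ne e with G ↾ A ≟ₛ D
        ... | yes e′ = contradiction e′ ne
        ... | no _ = e
      g-kernels : ∀ {B F} → B ∈ P → F ∈ R → g F ≡ nothing → InKer s (filter (class? g nothing) R) (F ↾ B)
      g-kernels {B} {F} B∈ F∈ gF with F ↾ A ≟ₛ D
      ... | no ne = InKer-mono final (kernels ih B∈ (∈-filter⁺ rest? F∈ ne) gF)

  HomogeneousSubfamily : ℕ → Family n → ℕ → Set
  HomogeneousSubfamily s R c = ∃[ R* ] ∃[ P* ]
    ((∀ {F} → F ∈ R* → F ∈ R) × Unique R* × Homogeneous s R* P* × length R ≤ c * length R*)

  -- Induction on the number of types in `P`. If the most popular label is `nothing`, its class is
  -- homogeneous. If it is `just (A , w)`, its class is clean for `A`, which leaves `P`; types that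
  -- were already clean stay so in subfamilies.
  homogeneous-subfamily : ∀ s p P R → length P ≤ p → (∀ {A} → A ∈ P → A ≢ full) → All Rainbow R → Unique R →
    (∀ {A} → A ≢ full → A ∉ P → Clean R A) →
    HomogeneousSubfamily s R (cleaningConstant k s p)
  homogeneous-subfamily s zero [] R _ _ rR uR clean = R , [] , id , uR ,
    record { proper = λ () ; kernels = λ () ; clean = clean } , ≤-reflexive (sym (*-identityˡ _))
  homogeneous-subfamily s (suc p) P R P≤ P-proper rR uR clean = choose (popular _≟ᴸ_ label nothing pairs R label∈)
    where
    open Cleaning s P P-proper
    open Labelling (labelling (length R) R ≤-refl rR)
    open ≤-Reasoning
    M = suc (suc p * (s * k))
    c₀ = cleaningConstant k s p
    pairs≤ : suc (length pairs) ≤ M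
    pairs≤ = s≤s (begin
      length pairs ≡⟨ length-map just (cartesianProduct P (upTo (s * k))) ⟩
      length (cartesianProduct P (upTo (s * k))) ≡⟨ length-cartesianProduct P (upTo (s * k)) ⟩
      length P * length (upTo (s * k)) ≡⟨ cong (length P *_) (length-upTo (s * k)) ⟩
      length P * (s * k) ≤⟨ *-monoˡ-≤ (s * k) P≤ ⟩
      suc p * (s * k) ∎)
    clean₁ : ∀ A w B → B ≢ full → B ∉ filter (λ B → ¬? (B ≟ₛ A)) P → ∀ {F G} → F ∈ R → G ∈ R →
      label F ≡ just (A , w) → label G ≡ just (A , w) → F ∩ G ≢ F ↾ B
    clean₁ A w B B≢ B∉ F∈ G∈ eF eG with B ≟ₛ A
    ... | yes refl = cleans F∈ G∈ eF eG
    ... | no B≢A = clean B≢ (λ B∈ → B∉ (∈-filter⁺ (λ B → ¬? (B ≟ₛ A)) B∈ B≢A)) F∈ G∈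
    choose : ∃[ l ] (l ∈ nothing ∷ pairs × length R ≤ suc (length pairs) * length (filter (class? label l) R)) →
      HomogeneousSubfamily s R (M * c₀)
    choose (nothing , here refl , le) = R₀ , P , proj₁ ∘ ∈-filter⁻ cl? , filter⁺ cl? uR ,
      record
        { proper = P-proper
        ; kernels = λ A∈ F∈ → let F∈R , e = ∈-filter⁻ cl? F∈ in kernels A∈ F∈R e
        ; clean = λ A≢ A∉ F∈ G∈ → clean A≢ A∉ (proj₁ (∈-filter⁻ cl? F∈)) (proj₁ (∈-filter⁻ cl? G∈)) } ,
      (begin
        length R ≤⟨ le ⟩
        suc (length pairs) * length R₀ ≤⟨ *-monoˡ-≤ (length R₀) pairs≤ ⟩
        M * length R₀ ≡⟨ cong (_* length R₀) (*-identityʳ M) ⟨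
        M * 1 * length R₀ ≤⟨ *-monoˡ-≤ (length R₀) (*-monoʳ-≤ M (cleaningConstant≥1 k s p)) ⟩
        M * c₀ * length R₀ ∎)
      where
      cl? = class? label nothing
      R₀ = filter cl? R
    choose (l , there l∈ , le) with (A , w) , Aw∈ , refl ← ∈-map⁻ just l∈
      with R* , P* , sub , uR* , hom , le* ← homogeneous-subfamily s p (filter (λ B → ¬? (B ≟ₛ A)) P) (filter (class? label l) R)
             (≤-pred (≤-trans (filter-notAll (λ B → ¬? (B ≟ₛ A)) P (lose (proj₁ (∈-cartesianProduct⁻ P _ Aw∈)) (λ ¬e → ¬e refl))) P≤))
             (λ B∈ → P-proper (proj₁ (∈-filter⁻ (λ B → ¬? (B ≟ₛ A)) B∈)))
             (tabulate λ F∈ → All-lookup rR (proj₁ (∈-filter⁻ (class? label l) F∈)))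
             (filter⁺ (class? label l) uR)
             (λ {B} B≢ B∉ F∈ G∈ → let F∈R , eF = ∈-filter⁻ (class? label l) F∈
                                      G∈R , eG = ∈-filter⁻ (class? label l) G∈
                                  in clean₁ A w B B≢ B∉ F∈R G∈R eF eG)
      = R* , P* , proj₁ ∘ ∈-filter⁻ (class? label l) ∘ sub , uR* , hom , (begin
        length R ≤⟨ le ⟩
        suc (length pairs) * length R₁ ≤⟨ *-mono-≤ pairs≤ le* ⟩
        M * (c₀ * length R*) ≡⟨ *-assoc M c₀ (length R*) ⟨
        M * c₀ * length R* ∎)
      where
      R₁ = filter (class? label l) R

-- Paths and cycles

nxt-< : ∀ {m} (i : Fin (suc m)) → suc (toℕ i) < suc m → toℕ (nxt i) ≡ suc (toℕ i)
nxt-< i lt = trans (toℕ-fromℕ< _) (m<n⇒m%n≡m lt)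

nxt-last : ∀ {m} (i : Fin (suc m)) → suc (toℕ i) ≡ suc m → toℕ (nxt i) ≡ 0
nxt-last {m} i e = trans (toℕ-fromℕ< _) (trans (cong (_% suc m) e) (n%n≡0 (suc m)))

infixr 5 _▸_
_▸_ : ∀ {A : Set} → A → (ℕ → A) → ℕ → A
(a ▸ f) zero = a
(a ▸ f) (suc i) = f i

-- A path of q members of R from u to v in which members at distance at least 2 are disjoint and,
-- under the assumption L, consecutive members share only their link vertex. It meets W only in its ends.
record Path {n} (R : Family n) (L : Set) (q : ℕ) (u v : Fin n) (W : List (Fin n)) : Set where
  field
    edge   : ℕ → Subset n
    node   : ℕ → Fin n
    edge∈  : ∀ {i} → i < q → edge i ∈ R
    node∈  : ∀ {i} → i < q → node i ∈ₛ edge i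
    node∈′ : ∀ {i} → i < q → node (suc i) ∈ₛ edge i
    start  : node 0 ≡ u
    end    : node q ≡ v
    meet   : ∀ {i j x} → i < j → j < q → x ∈ₛ edge i → x ∈ₛ edge j → j ≡ suc i × (L → x ≡ node j)
    fresh  : ∀ {i j} → i < j → j < q → node i ∉ₛ edge j
    ≢end   : ∀ {i} → i < q → node i ≢ v
    last   : ∀ {i} → i < q → v ∈ₛ edge i → suc i ≡ q
    avoid  : ∀ {i x} → i < q → x ∈ₛ edge i → x ∈ W → x ≡ u ⊎ x ≡ v

module _ {n} {R : Family n} {L : Set} where
  open Path

  []ₚ : ∀ {v W} → Path R L 0 v v W
  []ₚ {v} = record
    -- `full` is an arbitrary default, as a path of length 0 has no members.
    { edge = λ _ → full ; node = λ _ → v ; edge∈ = λ () ; node∈ = λ () ; node∈′ = λ ()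
    ; start = refl ; end = refl ; meet = λ _ () ; fresh = λ _ () ; ≢end = λ () ; last = λ () ; avoid = λ () }

  -- The tail `T` may have been built against a longer forbidden list `W′`, for instance one
  -- including the vertices of `E`; what this implies for `E` and `W` is passed in as hypotheses.
  consₚ : ∀ {q u v w W W′ E} (T : Path R L q w v W′) → E ∈ R → u ∈ₛ E → w ∈ₛ E → u ≢ v →
    (v ∈ₛ E → q ≡ 0) →
    (∀ {i x} → i < q → x ∈ₛ E → x ∈ₛ edge T i → i ≡ 0 × (L → x ≡ w)) →
    (∀ {i} → i < q → u ∉ₛ edge T i) →
    (∀ {x} → x ∈ₛ E → x ∈ W → x ≡ u ⊎ x ≡ v) →
    (∀ {i x} → i < q → x ∈ₛ edge T i → x ∈ W → x ≡ v) →
    Path R L (suc q) u v W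
  consₚ {q} {u} {v} {w} {W} {W′} {E} T E∈ u∈ w∈ u≢v v∈E meetE u∉ avoidE avoidT = record
    { edge = E ▸ edge T
    ; node = u ▸ node T
    ; edge∈ = λ { {zero} _ → E∈ ; {suc i} (s≤s i<) → edge∈ T i< }
    ; node∈ = λ { {zero} _ → u∈ ; {suc i} (s≤s i<) → node∈ T i< }
    ; node∈′ = λ { {zero} _ → subst (_∈ₛ E) (sym (start T)) w∈ ; {suc i} (s≤s i<) → node∈′ T i< }
    ; start = refl
    ; end = end T
    ; meet = meet′
    ; fresh = λ { {zero} {suc j} _ (s≤s j<) → u∉ j< ; {suc i} {suc j} (s≤s i<j) (s≤s j<) → fresh T i<j j< }
    ; ≢end = λ { {zero} _ → u≢v ; {suc i} (s≤s i<) → ≢end T i< }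
    ; last = λ { {zero} _ v∈ → cong suc (sym (v∈E v∈)) ; {suc i} (s≤s i<) v∈ → cong suc (last T i< v∈) }
    ; avoid = λ { {zero} _ → avoidE ; {suc i} (s≤s i<) x∈ x∈W → inj₂ (avoidT i< x∈ x∈W) } }
    where
    meet′ : ∀ {i j x} → i < j → j < suc q → x ∈ₛ (E ▸ edge T) i → x ∈ₛ (E ▸ edge T) j →
      j ≡ suc i × (L → x ≡ (u ▸ node T) j)
    meet′ {zero} {suc j} _ (s≤s j<) x∈ x∈′ with refl , lin ← meetE j< x∈ x∈′ =
      refl , λ l → trans (lin l) (sym (start T))
    meet′ {suc i} {suc j} (s≤s i<j) (s≤s j<) x∈ x∈′ with e , lin ← meet T i<j j< x∈ x∈′ = cong suc e , lin

  first : ∀ {q u v W} (T : Path R L q u v W) {i} → i < q → u ∈ₛ edge T i → i ≡ 0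
  first T {zero} _ _ = refl
  first T {suc i} i< u∈ = contradiction (subst (_∈ₛ edge T (suc i)) (sym (start T)) u∈) (fresh T z<s i<)

  -- The path meets `F₀` only in its ends, so `F₀`, placed at index 0, closes it to a cycle. The
  -- third vertex `t` makes `F₀` differ from every member of the path.
  module Closing {q u v F₀ t} (T : Path R L (suc q) u v (elements F₀)) (F₀∈ : F₀ ∈ R)
    (u∈ : u ∈ₛ F₀) (v∈ : v ∈ₛ F₀) (t∈ : t ∈ₛ F₀) (t≢u : t ≢ u) (t≢v : t ≢ v) where

    ℓ : ℕ
    ℓ = suc (suc q)

    F : ℕ → Subset n
    F = F₀ ▸ edge T

    V : ℕ → Fin n
    V = v ▸ node T

    -- `V ℓ` is the end of the path, which is `v`, that is `V 0`; hence wrapping around does not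
    -- change the vertex.
    V-nxt : (i : Fin ℓ) → V (toℕ (nxt i)) ≡ V (suc (toℕ i))
    V-nxt i with m≤n⇒m<n∨m≡n (toℕ<n i)
    ... | inj₁ lt = cong V (nxt-< i lt)
    ... | inj₂ e = trans (cong V (nxt-last i e)) (trans (sym (end T)) (cong V (sym e)))

    meet₀ : ∀ {j x} → j < suc q → x ∈ₛ F₀ → x ∈ₛ edge T j → (j ≡ 0 × x ≡ u) ⊎ (suc j ≡ suc q × x ≡ v)
    meet₀ j< x∈ x∈′ with avoid T j< x∈′ (∈-elements x∈)
    ... | inj₁ refl = inj₁ (first T j< x∈′ , refl)
    ... | inj₂ refl = inj₂ (last T j< x∈′ , refl)

    meetᶜ : ∀ {i j x} → i < j → j < ℓ → x ∈ₛ F i → x ∈ₛ F j →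
      (j ≡ suc i × (L → x ≡ V j)) ⊎ (i ≡ 0 × suc j ≡ ℓ × x ≡ v)
    meetᶜ {zero} {suc j} _ (s≤s j<) x∈ x∈′ with meet₀ j< x∈ x∈′
    ... | inj₁ (refl , refl) = inj₁ (refl , λ _ → sym (start T))
    ... | inj₂ (e , refl) = inj₂ (refl , cong suc e , refl)
    meetᶜ {suc i} {suc j} (s≤s i<j) (s≤s j<) x∈ x∈′ with e , lin ← meet T i<j j< x∈ x∈′ = inj₁ (cong suc e , lin)

    F-≢ : ∀ {i j} → i < j → j < ℓ → F i ≢ F j
    F-≢ {zero} {suc j} _ (s≤s j<) e with meet₀ j< t∈ (subst (t ∈ₛ_) e t∈)
    ... | inj₁ (_ , t≡u) = t≢u t≡u
    ... | inj₂ (_ , t≡v) = t≢v t≡v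
    F-≢ {suc i} {suc j} (s≤s i<j) (s≤s j<) e =
      fresh T i<j j< (subst (node T i ∈ₛ_) e (node∈ T (<-trans i<j j<)))

    V-≢ : ∀ {i j} → i < j → j < ℓ → V i ≢ V j
    V-≢ {zero} {suc j} _ (s≤s j<) e = ≢end T j< (sym e)
    V-≢ {suc i} {suc j} (s≤s i<j) (s≤s j<) e = fresh T i<j j< (subst (_∈ₛ edge T j) (sym e) (node∈ T j<))

    injective : ∀ {A : Set} {f : ℕ → A} → (∀ {i j} → i < j → j < ℓ → f i ≢ f j) →
      ∀ {i j : Fin ℓ} → f (toℕ i) ≡ f (toℕ j) → i ≡ j
    injective f≢ {i} {j} e with <-cmp (toℕ i) (toℕ j)
    ... | tri< lt _ _ = contradiction e (f≢ lt (toℕ<n j))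
    ... | tri≈ _ eq _ = toℕ-injective eq
    ... | tri> _ _ gt = contradiction (sym e) (f≢ gt (toℕ<n i))

    F∈ : ∀ {i} → i < ℓ → F i ∈ R
    F∈ {zero} _ = F₀∈
    F∈ {suc i} (s≤s i<) = edge∈ T i<

    V∈ : ∀ {i} → i < ℓ → V i ∈ₛ F i × V (suc i) ∈ₛ F i
    V∈ {zero} _ = v∈ , subst (_∈ₛ F₀) (sym (start T)) u∈
    V∈ {suc i} (s≤s i<) = node∈ T i< , node∈′ T i<

    V∈nxt : (i : Fin ℓ) → V (toℕ i) ∈ₛ F (toℕ i) × V (toℕ (nxt i)) ∈ₛ F (toℕ i)
    V∈nxt i = proj₁ (V∈ (toℕ<n i)) , subst (_∈ₛ F (toℕ i)) (sym (V-nxt i)) (proj₂ (V∈ (toℕ<n i)))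

    minimalCycle : ContainsMinimalCycle ℓ R
    minimalCycle = F ∘ toℕ , V ∘ toℕ , (λ i → F∈ (toℕ<n i)) , injective F-≢ , injective V-≢ , V∈nxt , disjoint
      where
      disjoint′ : ∀ (i j : Fin ℓ) → toℕ i < toℕ j → j ≢ nxt i → i ≢ nxt j → ∀ x → x ∈ₛ F (toℕ i) → x ∉ₛ F (toℕ j)
      disjoint′ i j i<j j≢ i≢ x x∈ x∈′ with meetᶜ i<j (toℕ<n j) x∈ x∈′
      ... | inj₁ (e , _) = j≢ (toℕ-injective (trans e (sym (nxt-< i (subst (_< ℓ) e (toℕ<n j))))))
      ... | inj₂ (e , e′ , _) = i≢ (toℕ-injective (trans e (sym (nxt-last j e′))))
      disjoint : ∀ (i j : Fin ℓ) → i ≢ j → j ≢ nxt i → i ≢ nxt j → ∀ x → x ∈ₛ F (toℕ i) → x ∉ₛ F (toℕ j)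
      disjoint i j i≢j j≢ i≢ x x∈ x∈′ with <-cmp (toℕ i) (toℕ j)
      ... | tri< lt _ _ = disjoint′ i j lt j≢ i≢ x x∈ x∈′
      ... | tri≈ _ e _ = i≢j (toℕ-injective e)
      ... | tri> _ _ gt = disjoint′ j i gt i≢ j≢ x x∈′ x∈

    linearCycle : L → ContainsLinearCycle ℓ R
    linearCycle l = F ∘ toℕ , V ∘ toℕ , (λ i → F∈ (toℕ<n i)) , injective V-≢ , trace , V∈nxt , linear
      where
      linear′ : ∀ (i j : Fin ℓ) → toℕ i < toℕ j → ∀ x → x ∈ₛ F (toℕ i) → x ∈ₛ F (toℕ j) → ∃[ m ] V (toℕ {ℓ} m) ≡ x
      linear′ i j i<j x x∈ x∈′ with meetᶜ i<j (toℕ<n j) x∈ x∈′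
      ... | inj₁ (_ , lin) = j , sym (lin l)
      ... | inj₂ (_ , _ , e) = zero , sym e
      linear : ∀ (i j : Fin ℓ) → i ≢ j → ∀ x → x ∈ₛ F (toℕ i) → x ∈ₛ F (toℕ j) → ∃[ m ] V (toℕ {ℓ} m) ≡ x
      linear i j i≢j x x∈ x∈′ with <-cmp (toℕ i) (toℕ j)
      ... | tri< lt _ _ = linear′ i j lt x x∈ x∈′
      ... | tri≈ _ e _ = contradiction (toℕ-injective e) i≢j
      ... | tri> _ _ gt = linear′ j i gt x x∈′ x∈
      trace′ : ∀ (i m : Fin ℓ) → V (toℕ m) ∈ₛ F (toℕ i) → V (toℕ m) ≡ V (toℕ i) ⊎ V (toℕ m) ≡ V (suc (toℕ i))
      trace′ i m x∈ with <-cmp (toℕ i) (toℕ m)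
      ... | tri≈ _ e _ = inj₁ (cong V (sym e))
      ... | tri< lt _ _ with meetᶜ lt (toℕ<n m) x∈ (proj₁ (V∈ (toℕ<n m)))
      ...   | inj₁ (e , _) = inj₂ (cong V e)
      ...   | inj₂ (e , _ , e′) = inj₁ (trans e′ (cong V (sym e)))
      trace′ i m x∈ | tri> _ _ gt with meetᶜ gt (toℕ<n i) (proj₁ (V∈ (toℕ<n m))) x∈
      ...   | inj₁ (_ , lin) = inj₁ (lin l)
      ...   | inj₂ (_ , e , e′) = inj₂ (trans e′ (trans (sym (end T)) (cong V (sym e))))
      trace : ∀ (i : Fin ℓ) x → (x ∈ₛ F (toℕ i) × (∃[ m ] V (toℕ {ℓ} m) ≡ x)) → x ≡ V (toℕ i) ⊎ x ≡ V (toℕ (nxt i))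
      trace i x (x∈ , m , refl) with trace′ i m x∈
      ... | inj₁ e = inj₁ e
      ... | inj₂ e = inj₂ (trans e (sym (V-nxt i)))

-- Pairs of colours and complements

x∉p-x : ∀ {n} (x : Fin n) p → x ∉ₛ p - x
x∉p-x zero (_ ∷ p) ()
x∉p-x (suc x) (_ ∷ p) (there x∈) = x∉p-x x p x∈

pair : ∀ {k} → Fin k → Fin k → Subset k
pair a b = ⁅ a ⁆ ∪ ⁅ b ⁆

∈pairˡ : ∀ {k} (a b : Fin k) → a ∈ₛ pair a b
∈pairˡ a b = x∈p∪q⁺ (inj₁ (x∈⁅x⁆ a))

∈pairʳ : ∀ {k} (a b : Fin k) → b ∈ₛ pair a b
∈pairʳ a b = x∈p∪q⁺ {p = ⁅ a ⁆} (inj₂ (x∈⁅x⁆ b))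

∈pair⁻ : ∀ {k} {a b c : Fin k} → c ∈ₛ pair a b → c ≡ a ⊎ c ≡ b
∈pair⁻ {a = a} {b} c∈ with x∈p∪q⁻ ⁅ a ⁆ ⁅ b ⁆ c∈
... | inj₁ c∈a = inj₁ (x∈⁅y⁆⇒x≡y a c∈a)
... | inj₂ c∈b = inj₂ (x∈⁅y⁆⇒x≡y b c∈b)

co : ∀ {k} → Fin k → Subset k
co a = ∁ ⁅ a ⁆

∈co : ∀ {k} {a c : Fin k} → c ≢ a → c ∈ₛ co a
∈co {a = a} c≢a = x∉p⇒x∈∁p λ c∈ → c≢a (x∈⁅y⁆⇒x≡y a c∈)

∈co⁻ : ∀ {k} {a c : Fin k} → c ∈ₛ co a → c ≢ a
∈co⁻ {a = a} c∈ refl = x∈∁p⇒x∉p c∈ (x∈⁅x⁆ a)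

co₂ : ∀ {k} → Fin k → Fin k → Subset k
co₂ a b = ∁ (pair a b)

∈co₂ : ∀ {k} {a b c : Fin k} → c ≢ a → c ≢ b → c ∈ₛ co₂ a b
∈co₂ c≢a c≢b = x∉p⇒x∈∁p λ c∈ → [ c≢a , c≢b ]′ (∈pair⁻ c∈)

∈co₂⁻ : ∀ {k} {a b c : Fin k} → c ∈ₛ co₂ a b → c ≢ a × c ≢ b
∈co₂⁻ {a = a} {b} c∈ = (λ { refl → x∈∁p⇒x∉p c∈ (∈pairˡ a b) }) , (λ { refl → x∈∁p⇒x∉p c∈ (∈pairʳ a b) })

length-++-elements : ∀ {n} W (E : Subset n) {k} → ∣ E ∣ ≡ k → length (W ++ elements E) ≡ length W + k
length-++-elements W E e = trans (length-++ W) (cong (length W +_) (trans (length-elements E) e))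

-- Consequences of homogeneity

module Structure {n k : ℕ} (χ : Fin n → Fin k) where
  open Types χ
  open Rainbow

  module _ {s : ℕ} {R : Family n} {P : List (Subset k)} (hom : Homogeneous s R P)
    (rainbow : ∀ {F} → F ∈ R → Rainbow F) where
    open Homogeneous hom

    extend : ∀ {A F} → A ∈ P → F ∈ R → ∀ W → length W < s →
      ∃[ G ] (G ∈ R × F ↾ A ⊆ G × (∀ {x} → x ∈ₛ G → x ∈ W → x ∈ₛ F ↾ A))
    extend A∈ F∈ = avoiding-member (kernels A∈ F∈)

    -- Generic extensions of the traces of types A and B meet exactly in the trace of type A ∩ B.
    ∩-closed : k + k < s → ∀ {A B F} → F ∈ R → A ∈ P → B ∈ P → A ∩ B ∈ P
    ∩-closed 2k<s {A} {B} {F} F∈ A∈ B∈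
      with G , G∈ , A⊆G , avG ← extend A∈ F∈ (elements F)
             (subst (_< s) (sym (trans (length-elements F) (size (rainbow F∈)))) (≤-trans (s≤s (m≤m+n k k)) 2k<s))
      with H , H∈ , B⊆H , avH ← extend B∈ F∈ (elements F ++ elements G)
             (subst (_< s) (sym (trans (length-++-elements (elements F) G (size (rainbow G∈)))
               (cong (_+ k) (trans (length-elements F) (size (rainbow F∈)))))) 2k<s)
      with (A ∩ B) ∈ᶠ? P
    ... | yes A∩B∈ = A∩B∈
    ... | no A∩B∉ = contradiction (⊆-antisym to from) (clean A∩B≢ A∩B∉ G∈ H∈)
      where
      A∩B≢ : A ∩ B ≢ full
      A∩B≢ e = let a , a∉ = ∃∉ (proper A∈) in a∉ (p∩q⊆p A B (subst (a ∈ₛ_) (sym e) ∈⊤))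
      to : G ∩ H ⊆ G ↾ (A ∩ B)
      to x∈ = let x∈G , x∈H = x∈p∩q⁻ G H x∈
                  x∈F , c∈B = ∈↾⁻ {F} {B} (avH x∈H (∈-++⁺ʳ (elements F) (∈-elements x∈G)))
                  _ , c∈A = ∈↾⁻ {F} {A} (avG x∈G (∈-elements x∈F))
              in ∈↾⁺ x∈G (x∈p∩q⁺ (c∈A , c∈B))
      from : G ↾ (A ∩ B) ⊆ G ∩ H
      from {x} x∈ =
        let x∈G , c∈ = ∈↾⁻ {G} {A ∩ B} x∈
            c∈A , c∈B = x∈p∩q⁻ A B c∈
            y , y∈F , e = vertex (rainbow F∈) (χ x)
            y≡x = unique (rainbow G∈) (A⊆G (∈↾⁺ y∈F (subst (_∈ₛ A) (sym e) c∈A))) x∈G e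
        in x∈p∩q⁺ (x∈G , subst (_∈ₛ H) y≡x (B⊆H (∈↾⁺ y∈F (subst (_∈ₛ B) (sym e) c∈B))))

    -- `A` is the intersection of the types that separate it from the single colours outside it, so
    -- `∩-closed` puts it into `P`.
    ⋂-closed : k + k < s → ∀ {A F} → F ∈ R → A ≢ full →
      (∀ {a} → a ∉ₛ A → ∃[ B ] (B ∈ P × A ⊆ B × a ∉ₛ B)) → A ∈ P
    ⋂-closed 2k<s {A} F∈ A≢ separate =
      let B , B∈ , A⊆B , sep = go (allFin k)
      in subst (_∈ P) (⊆-antisym (λ {a} a∈B → decidable-stable (a ∈? A) λ a∉ → sep (∈-allFin a) a∉ a∈B) A⊆B) B∈
      where
      go : ∀ as → ∃[ B ] (B ∈ P × A ⊆ B × (∀ {a} → a ∈ as → a ∉ₛ A → a ∉ₛ B))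
      -- `full` is not in `P`, so the intersection starts from a type separating some colour outside
      -- `A`.
      go [] = let a , a∉ = ∃∉ A≢ ; B , B∈ , A⊆B , _ = separate a∉ in B , B∈ , A⊆B , λ ()
      go (a ∷ as) with go as | a ∈? A
      ... | B , B∈ , A⊆B , sep | yes a∈ = B , B∈ , A⊆B , λ { (here refl) a∉ → contradiction a∈ a∉ ; (there b∈) → sep b∈ }
      ... | B , B∈ , A⊆B , sep | no a∉ with B′ , B′∈ , A⊆B′ , a∉B′ ← separate a∉ =
        B ∩ B′ , ∩-closed 2k<s F∈ B∈ B′∈ , (λ x∈ → x∈p∩q⁺ (A⊆B x∈ , A⊆B′ x∈)) ,
        λ { (here refl) _ b∈∩ → a∉B′ (p∩q⊆q B B′ b∈∩) ; (there b∈) b∉ b∈∩ → sep b∈ b∉ (p∩q⊆p B B′ b∈∩) }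

    -- The centre of `F` is its vertex of colour `c`. A proper subset containing it has a type
    -- containing `c`, and this type is an intersection of complements `co a` with `a ≢ c`.
    centralized : k + k < s → (c : Fin k) → (∀ {a} → a ≢ c → co a ∈ P) → Centralized s R
    centralized 2k<s c co∈ = tabulate λ {F} F∈ →
      let x , x∈ , e = vertex (rainbow F∈) c in
      x , x∈ , λ D D⊂F x∈D → subst (InKer s R) (sym (↾-colours (rainbow F∈) (proj₁ D⊂F)))
        (kernels (⋂-closed 2k<s F∈ (D≢ F∈ D⊂F) λ {a} a∉ →
          co a , co∈ (λ { refl → a∉ (∈⟪⟫⁺ (hasColour? D) (x , x∈D , e)) }) ,
          (λ b∈ → ∈co λ { refl → a∉ b∈ }) , λ a∈ → ∈co⁻ a∈ refl) F∈)
      where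
      D≢ : ∀ {F D} → F ∈ R → D ⊂ F → colours D ≢ full
      D≢ {F} {D} F∈ (D⊆F , y , y∈F , y∉D) e =
        let z , z∈D , e′ = ∈⟪⟫⁻ (hasColour? D) (subst (χ y ∈ₛ_) (sym e) ∈⊤)
        in y∉D (subst (_∈ₛ D) (unique (rainbow F∈) (D⊆F z∈D) y∈F e′) z∈D)

    -- No type of P contains co₂ a b, so the traces of type co₂ a b are own subsets.
    own-subset-bound : Unique R → ∀ {a b} → a ≢ b → co a ∉ P → co b ∉ P → co₂ a b ∉ P → length R ≤ n C (k ∸ 2)
    own-subset-bound uR {a} {b} a≢b a∉ b∉ ab∉ = subst (length R ≤_) (length-subsetsOfSize n (k ∸ 2))
      (injection-length (λ i → lookup R i ↾ co₂ a b) (subsetsOfSize n (k ∸ 2))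
        (λ {i} {j} e → Unique⇒lookup-injective uR (trace-injective (∈-lookup i) (∈-lookup j) e))
        (λ i → subst (λ m → lookup R i ↾ co₂ a b ∈ subsetsOfSize n m) (trace-size (∈-lookup i)) (∈-subsetsOfSize _)))
      where
      -- Without `a`, the type `A` would be `co a` or `co₂ a b`, according to whether it contains
      -- `b`, and neither lies in `P`.
      missing : ∀ {A a b} → (∀ {c} → c ≢ a → c ≢ b → c ∈ₛ A) → A ∈ P → co a ∉ P → co₂ a b ∉ P → a ∈ₛ A
      missing {A} {a} {b} ⊆A A∈ a∉ ab∉ with a ∈? A | b ∈? A
      ... | yes a∈ | _ = a∈
      ... | no a∉A | yes b∈ = contradiction (subst (_∈ P) (⊆-antisym (λ c∈ → ∈co λ { refl → a∉A c∈ }) from) A∈) a∉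
        where
        from : co a ⊆ A
        from {c} c∈ with c ≟ᶠ b
        ... | yes refl = b∈
        ... | no c≢b = ⊆A (∈co⁻ c∈) c≢b
      ... | no a∉A | no b∉A = contradiction (subst (_∈ P) (⊆-antisym
        (λ c∈ → ∈co₂ (λ { refl → a∉A c∈ }) (λ { refl → b∉A c∈ }))
        (λ c∈ → ⊆A (proj₁ (∈co₂⁻ {a = a} {b} c∈)) (proj₂ (∈co₂⁻ {a = a} {b} c∈)))) A∈) ab∉
      trace-injective : ∀ {F G} → F ∈ R → G ∈ R → F ↾ co₂ a b ≡ G ↾ co₂ a b → F ≡ G
      trace-injective {F} {G} F∈ G∈ e with colours (F ∩ G) ≟ₛ full
      ... | yes all = ⊆-antisym F⊆G λ {x} x∈G →
          let y , y∈F , e′ = vertex (rainbow F∈) (χ x)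
          in subst (_∈ₛ F) (unique (rainbow G∈) (F⊆G y∈F) x∈G e′) y∈F
        where
        F⊆G : F ⊆ G
        F⊆G {x} x∈F =
          let y , y∈ , e′ = ∈⟪⟫⁻ (hasColour? (F ∩ G)) (subst (χ x ∈ₛ_) (sym all) ∈⊤)
              y∈F , y∈G = x∈p∩q⁻ F G y∈
          in subst (_∈ₛ G) (unique (rainbow F∈) y∈F x∈F e′) y∈G
      -- The type of `F ∩ G` is neither `full` nor in `P`, so cleanness excludes this intersection.
      ... | no A≢ = contradiction (↾-colours (rainbow F∈) (p∩q⊆p F G)) (clean A≢ A∉ F∈ G∈)
        where
        A = colours (F ∩ G)
        ⊆A : ∀ {c} → c ≢ a → c ≢ b → c ∈ₛ A
        ⊆A {c} c≢a c≢b =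
          let y , y∈F , e′ = vertex (rainbow F∈) c
              y∈↾ = ∈↾⁺ {F} {co₂ a b} y∈F (subst (_∈ₛ co₂ a b) (sym e′) (∈co₂ c≢a c≢b))
              y∈G = proj₁ (∈↾⁻ {G} {co₂ a b} (subst (y ∈ₛ_) e y∈↾))
          in ∈⟪⟫⁺ (hasColour? (F ∩ G)) (y , x∈p∩q⁺ (y∈F , y∈G) , e′)
        A∉ : A ∉ P
        A∉ A∈ = A≢ (⊆-antisym (λ {c} _ → ∈⊤ {x = c}) all)
          where
          all : full ⊆ A
          all {c} _ with c ≟ᶠ a | c ≟ᶠ b
          ... | yes refl | _ = missing ⊆A A∈ a∉ ab∉
          ... | no _ | yes refl = missing (λ c≢b c≢a → ⊆A c≢a c≢b) A∈ b∉ (subst (λ B → ∁ B ∉ P) (∪-comm ⁅ a ⁆ ⁅ b ⁆) ab∉)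
          ... | no c≢a | no c≢b = ⊆A c≢a c≢b
      trace-size : ∀ {F} → F ∈ R → ∣ F ↾ co₂ a b ∣ ≡ k ∸ 2
      trace-size {F} F∈
        with x , x∈ , ex ← vertex (rainbow F∈) a
        with y , y∈ , ey ← vertex (rainbow F∈) b
        = begin
          ∣ F ↾ co₂ a b ∣ ≡⟨ cong ∣_∣ (⊆-antisym to from) ⟩
          ∣ F - x - y ∣ ≡⟨⟩
          2 + ∣ F - x - y ∣ ∸ 2 ≡⟨ cong (λ m → suc m ∸ 2) (∣p∣≡1+∣p-x∣ (x∈p∧x≢y⇒x∈p-y y∈ y≢x)) ⟨
          suc ∣ F - x ∣ ∸ 2 ≡⟨ cong (_∸ 2) (∣p∣≡1+∣p-x∣ x∈) ⟨
          ∣ F ∣ ∸ 2 ≡⟨ cong (_∸ 2) (size (rainbow F∈)) ⟩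
          k ∸ 2 ∎
        where
        open ≡-Reasoning
        y≢x : y ≢ x
        y≢x refl = a≢b (trans (sym ex) ey)
        to : F ↾ co₂ a b ⊆ F - x - y
        to z∈ = let z∈F , c∈ = ∈↾⁻ {F} {co₂ a b} z∈
                    c≢a , c≢b = ∈co₂⁻ {a = a} {b} c∈
                in x∈p∧x≢y⇒x∈p-y (x∈p∧x≢y⇒x∈p-y z∈F (λ { refl → c≢a ex })) (λ { refl → c≢b ey })
        from : F - x - y ⊆ F ↾ co₂ a b
        from {z} z∈ =
          let z∈′ = p─q⊆p (F - x) ⁅ y ⁆ z∈
              z∈F = p─q⊆p F ⁅ x ⁆ z∈′
          in ∈↾⁺ z∈F (∈co₂
            (λ e → x∉p-x x F (subst (_∈ₛ F - x) (unique (rainbow F∈) z∈F x∈ (trans e (sym ex))) z∈′))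
            (λ e → x∉p-x y (F - x) (subst (_∈ₛ F - x - y) (unique (rainbow F∈) z∈F y∈ (trans e (sym ey))) z∈)))

-- Paths between two vertices of a member

module PathBuilding {n k : ℕ} (χ : Fin n → Fin k) where
  open Types χ
  open Rainbow
  open Path
  open Structure χ

  module Build (L : Set) (1≤k : 1 ≤ k) {s : ℕ} {R : Family n} {P : List (Subset k)} (hom : Homogeneous s R P)
    (rainbow : ∀ {F} → F ∈ R → Rainbow F) where

    ≢-colours : ∀ {x y : Fin n} {a b} → χ x ≡ a → χ y ≡ b → a ≢ b → x ≢ y
    ≢-colours ea eb a≢b refl = a≢b (trans (sym ea) eb)

    ∈pair-trace : ∀ {x y F u v z} → F ∈ R → u ∈ₛ F → χ u ≡ x → v ∈ₛ F → χ v ≡ y →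
      z ∈ₛ F ↾ pair x y → z ≡ u ⊎ z ≡ v
    ∈pair-trace {x} {y} {F} F∈ u∈ eu v∈ ev z∈ with z∈F , c∈ ← ∈↾⁻ {F} {pair x y} z∈ with ∈pair⁻ c∈
    ... | inj₁ e = inj₁ (unique (rainbow F∈) z∈F u∈ (trans e (sym eu)))
    ... | inj₂ e = inj₂ (unique (rainbow F∈) z∈F v∈ (trans e (sym ev)))

    ∈trace : ∀ {F A u a} → u ∈ₛ F → χ u ≡ a → a ∈ₛ A → u ∈ₛ F ↾ A
    ∈trace {A = A} u∈ e a∈ = ∈↾⁺ u∈ (subst (_∈ₛ A) (sym e) a∈)

    ∉trace : ∀ {F A u a} → χ u ≡ a → a ∉ₛ A → u ∉ₛ F ↾ A
    ∉trace {F} {A} e a∉ u∈ = a∉ (subst (_∈ₛ A) e (proj₂ (∈↾⁻ {F} {A} u∈)))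

    -- The budget invariant of all path constructions: each member put on the forbidden list costs
    -- `k` out of `s`, and what remains gives the strict bound required by `extend`.
    room : ∀ w q → w + suc q * k ≤ s → w < s
    room w q le = ≤-trans (≤-trans (≤-reflexive (+-comm 1 w)) (+-monoʳ-≤ w (≤-trans 1≤k (m≤m+n k (q * k))))) le

    room′ : ∀ W {E} → E ∈ R → ∀ q → length W + suc q * k ≤ s → length (W ++ elements E) + q * k ≤ s
    room′ W {E} E∈ q le = subst (_≤ s) (sym (trans (cong (_+ q * k) (length-++-elements W E (size (rainbow E∈))))
      (+-assoc (length W) k (q * k)))) le

    single : ∀ {x y F u v W} → x ≢ y → pair x y ∈ P → F ∈ R → u ∈ₛ F → χ u ≡ x → v ∈ₛ F → χ v ≡ y →
      length W < s → Path R L 1 u v W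
    single {x} {y} {W = W} x≢y xy∈ F∈ u∈ eu v∈ ev W<s
      with G , G∈ , ⊆G , avG ← extend hom rainbow xy∈ F∈ W W<s =
      consₚ {W′ = []} []ₚ G∈ (⊆G (∈trace u∈ eu (∈pairˡ x y))) (⊆G (∈trace v∈ ev (∈pairʳ x y)))
        (≢-colours eu ev x≢y) (λ _ → refl) (λ ()) (λ ())
        (λ x∈ x∈W → ∈pair-trace F∈ u∈ eu v∈ ev (avG x∈ x∈W)) (λ ())

    -- The end v stays fixed, while the other end alternates between colours x and z.
    linearPath : ∀ {y A} → A ∈ P → y ∉ₛ A → ∀ q {x z} → x ≢ z → x ∈ₛ A → z ∈ₛ A → pair x y ∈ P → pair z y ∈ P →
      ∀ {F u v} → F ∈ R → u ∈ₛ F → χ u ≡ x → v ∈ₛ F → χ v ≡ y →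
      ∀ W → length W + suc q * k ≤ s → Path R L (suc q) u v W
    linearPath A∈ y∉ zero x≢z x∈A z∈A xy∈ zy∈ F∈ u∈ eu v∈ ev W W≤ =
      single (λ { refl → y∉ x∈A }) xy∈ F∈ u∈ eu v∈ ev (room _ 0 W≤)
    linearPath {y} {A} A∈ y∉ (suc q) {x} {z} x≢z x∈A z∈A xy∈ zy∈ {F} {u} {v} F∈ u∈ eu v∈ ev W W≤
      -- `F′` is auxiliary and not a member of the path. It meets `W` at most in `u` and `v`, so its
      -- vertex `w` of colour `z` is fresh.
      with F′ , F′∈ , ⊆F′ , avF′ ← extend hom rainbow xy∈ F∈ W (room _ (suc q) W≤)
      with w , w∈ , ew ← vertex (rainbow F′∈) z
      -- The first member `E` contains `u` and `w`, and misses `v` because `y` is not in `A`.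
      with E , E∈ , ⊆E , avE ← extend hom rainbow A∈ F′∈ (W ++ elements F′) (room _ q (room′ W F′∈ (suc q) W≤))
      = consₚ T E∈ (⊆E (∈trace u∈′ eu x∈A)) (⊆E (∈trace w∈ ew z∈A)) u≢v (λ v∈E → contradiction v∈E v∉E)
          meetE u∉T avoidE avoidT
      where
      x≢y : x ≢ y
      x≢y refl = y∉ x∈A
      z≢y : z ≢ y
      z≢y refl = y∉ z∈A
      u∈′ : u ∈ₛ F′
      u∈′ = ⊆F′ (∈trace u∈ eu (∈pairˡ x y))
      v∈′ : v ∈ₛ F′
      v∈′ = ⊆F′ (∈trace v∈ ev (∈pairʳ x y))
      T : Path R L (suc q) w v (W ++ elements E)
      -- The remaining path starts from `w` and `v` inside `F′`, with `x` and `z` exchanged, and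
      -- treats `E` as forbidden.
      T = linearPath A∈ y∉ q (x≢z ∘ sym) z∈A x∈A zy∈ xy∈ F′∈ w∈ ew v∈′ ev (W ++ elements E) (room′ W E∈ (suc q) W≤)
      u≢v = ≢-colours eu ev x≢y
      u≢w = ≢-colours eu ew x≢z
      w≢v = ≢-colours ew ev z≢y
      v∉E : v ∉ₛ E
      v∉E v∈E = ∉trace {F′} {A} ev y∉ (avE v∈E (∈-++⁺ʳ W (∈-elements v∈′)))
      F′∩W : ∀ {t} → t ∈ₛ F′ → t ∈ W → t ≡ u ⊎ t ≡ v
      F′∩W t∈ t∈W = ∈pair-trace F∈ u∈ eu v∈ ev (avF′ t∈ t∈W)
      E∩T : ∀ {i t} → i < suc q → t ∈ₛ E → t ∈ₛ edge T i → t ≡ w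
      E∩T i< t∈ t∈T with avoid T i< t∈T (∈-++⁺ʳ W (∈-elements t∈))
      ... | inj₁ e = e
      ... | inj₂ refl = contradiction t∈ v∉E
      meetE : ∀ {i t} → i < suc q → t ∈ₛ E → t ∈ₛ edge T i → i ≡ 0 × (L → t ≡ w)
      meetE {i} i< t∈ t∈T with refl ← E∩T i< t∈ t∈T = first T i< t∈T , λ _ → refl
      u∉T : ∀ {i} → i < suc q → u ∉ₛ edge T i
      u∉T i< u∈T = u≢w (E∩T i< (⊆E (∈trace u∈′ eu x∈A)) u∈T)
      avoidE : ∀ {t} → t ∈ₛ E → t ∈ W → t ≡ u ⊎ t ≡ v
      avoidE t∈ t∈W = F′∩W (proj₁ (∈↾⁻ {F′} {A} (avE t∈ (∈-++⁺ˡ t∈W)))) t∈W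
      avoidT : ∀ {i t} → i < suc q → t ∈ₛ edge T i → t ∈ W → t ≡ v
      avoidT i< t∈ t∈W with avoid T i< t∈ (∈-++⁺ˡ t∈W)
      ... | inj₂ e = e
      ... | inj₁ refl = contradiction (F′∩W w∈ t∈W) [ u≢w ∘ sym , w≢v ]′

    -- The path advances two members at a time; these two share all vertices of colours other than x and y.
    module _ (¬L : ¬ L) {x y a} (x≢y : x ≢ y) (a≢x : a ≢ x) (a≢y : a ≢ y)
      (xy∈ : pair x y ∈ P) (cox∈ : co x ∈ P) (coy∈ : co y ∈ P) where

      minimalPath : ∀ q {F u v} → F ∈ R → u ∈ₛ F → χ u ≡ x → v ∈ₛ F → χ v ≡ y →
        ∀ W → length W + suc q * k ≤ s → Path R L (suc q) u v W
      minimalPath zero F∈ u∈ eu v∈ ev W W≤ = single x≢y xy∈ F∈ u∈ eu v∈ ev (room _ 0 W≤)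
      minimalPath (suc q) {F} {u} {v} F∈ u∈ eu v∈ ev W W≤
        with F′ , F′∈ , ⊆F′ , avF′ ← extend hom rainbow xy∈ F∈ W (room _ (suc q) W≤)
        -- `F″` drops `u` but keeps `v`, while `E` drops `v` but keeps `u`; both keep the vertex `b`
        -- of colour `a`.
        with F″ , F″∈ , ⊆F″ , avF″ ← extend hom rainbow cox∈ F′∈ (W ++ elements F′) (room _ q (room′ W F′∈ (suc q) W≤))
        with E , E∈ , ⊆E , avE ← extend hom rainbow coy∈ F′∈ (W ++ elements F′) (room _ q (room′ W F′∈ (suc q) W≤))
        with b , b∈ , eb ← vertex (rainbow F′∈) a
        = finish q W≤
        where
        u∈′ : u ∈ₛ F′
        u∈′ = ⊆F′ (∈trace u∈ eu (∈pairˡ x y))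
        v∈′ : v ∈ₛ F′
        v∈′ = ⊆F′ (∈trace v∈ ev (∈pairʳ x y))
        v∈″ : v ∈ₛ F″
        v∈″ = ⊆F″ (∈trace v∈′ ev (∈co (x≢y ∘ sym)))
        b∈″ : b ∈ₛ F″
        b∈″ = ⊆F″ (∈trace b∈ eb (∈co a≢x))
        b∈E : b ∈ₛ E
        b∈E = ⊆E (∈trace b∈ eb (∈co a≢y))
        u∈E : u ∈ₛ E
        u∈E = ⊆E (∈trace u∈′ eu (∈co x≢y))
        u≢v = ≢-colours eu ev x≢y
        b≢v = ≢-colours eb ev a≢y
        b≢u = ≢-colours eb eu a≢x
        ∉co : ∀ {c : Fin k} → c ∉ₛ co c
        ∉co c∈ = ∈co⁻ c∈ refl
        u∉″ : u ∉ₛ F″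
        u∉″ u∈″ = ∉trace {F′} {co x} eu ∉co (avF″ u∈″ (∈-++⁺ʳ W (∈-elements u∈′)))
        v∉E : v ∉ₛ E
        v∉E v∈E = ∉trace {F′} {co y} ev ∉co (avE v∈E (∈-++⁺ʳ W (∈-elements v∈′)))
        F′∩W : ∀ {t} → t ∈ₛ F′ → t ∈ W → t ≡ u ⊎ t ≡ v
        F′∩W t∈ t∈W = ∈pair-trace F∈ u∈ eu v∈ ev (avF′ t∈ t∈W)
        b∉W : b ∉ W
        b∉W b∈W = [ b≢u , b≢v ]′ (F′∩W b∈ b∈W)
        E∩W : ∀ {t} → t ∈ₛ E → t ∈ W → t ≡ u ⊎ t ≡ v
        E∩W t∈ t∈W = F′∩W (proj₁ (∈↾⁻ {F′} {co y} (avE t∈ (∈-++⁺ˡ t∈W)))) t∈W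
        F″∩W : ∀ {t} → t ∈ₛ F″ → t ∈ W → t ≡ v
        F″∩W t∈ t∈W with F′∩W (proj₁ (∈↾⁻ {F′} {co x} (avF″ t∈ (∈-++⁺ˡ t∈W)))) t∈W
        ... | inj₁ refl = contradiction t∈ u∉″
        ... | inj₂ e = e
        finish : ∀ q → length W + suc (suc q) * k ≤ s → Path R L (suc (suc q)) u v W
        -- For two members, `E` leads from `u` to `b` and `F″` from `b` to `v`.
        finish zero W≤ = consₚ {W′ = W}
          (consₚ {W = W} {W′ = W} []ₚ F″∈ b∈″ v∈″ b≢v (λ _ → refl) (λ ()) (λ ()) (λ t∈ t∈W → inj₂ (F″∩W t∈ t∈W)) (λ ()))
          E∈ u∈E b∈E u≢v (λ v∈E → contradiction v∈E v∉E)
          (λ { {zero} _ _ _ → refl , λ l → contradiction l ¬L ; {suc i} (s≤s ()) })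
          (λ { {zero} _ → u∉″ ; {suc i} (s≤s ()) })
          E∩W
          (λ { {zero} _ → F″∩W ; {suc i} (s≤s ()) })
        finish (suc q) W≤
          -- For longer paths `F″` is only auxiliary: `G` drops `v` from it and leads from `b` to
          -- `c`, the vertex of colour `x` in `F″`, and the recursion connects `c` to `v`.
          with G , G∈ , ⊆G , avG ← extend hom rainbow coy∈ F″∈ (W ++ elements F′) (room _ (suc q) (room′ W F′∈ (suc (suc q)) W≤))
          with c , c∈″ , ec ← vertex (rainbow F″∈) x
          = consₚ {W′ = W} T′ E∈ u∈E b∈E u≢v (λ v∈E → contradiction v∈E v∉E)
            (λ { {zero} _ _ _ → refl , (λ l → contradiction l ¬L)
               ; {suc i} (s≤s i<) t∈ t∈T → contradiction t∈ (E∩T i< t∈T) })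
            (λ { {zero} _ → u∉G ; {suc i} (s≤s i<) u∈T → E∩T i< u∈T u∈E })
            E∩W
            (λ i< t∈ t∈W → [ (λ { refl → contradiction t∈W b∉W }) , id ]′ (avoid T′ i< t∈ t∈W))
          where
          W₂ = (W ++ elements E) ++ elements G
          T : Path R L (suc q) c v W₂
          T = minimalPath q F″∈ c∈″ ec v∈″ ev W₂ (room′ (W ++ elements E) G∈ (suc q) (room′ W E∈ (suc (suc q)) W≤))
          c∈G : c ∈ₛ G
          c∈G = ⊆G (∈trace c∈″ ec (∈co x≢y))
          b∈G : b ∈ₛ G
          b∈G = ⊆G (∈trace b∈″ eb (∈co a≢y))
          v∉G : v ∉ₛ G
          v∉G v∈G = ∉trace {F″} {co y} ev ∉co (avG v∈G (∈-++⁺ʳ W (∈-elements v∈′)))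
          u∉G : u ∉ₛ G
          u∉G u∈G = u∉″ (proj₁ (∈↾⁻ {F″} {co y} (avG u∈G (∈-++⁺ʳ W (∈-elements u∈′)))))
          c≢v = ≢-colours ec ev x≢y
          b≢c = ≢-colours eb ec a≢x
          c∉E : c ∉ₛ E
          -- The only vertex of colour `x` in `E` is `u`, which `F″` avoids. Hence `E` is disjoint
          -- from all members of `T`.
          c∉E c∈E = u∉″ (subst (_∈ₛ F″) (unique (rainbow E∈) c∈E u∈E (trans ec (sym eu))) c∈″)
          G∩W : ∀ {t} → t ∈ₛ G → t ∉ W
          G∩W t∈ t∈W with refl ← F″∩W (proj₁ (∈↾⁻ {F″} {co y} (avG t∈ (∈-++⁺ˡ t∈W)))) t∈W = v∉G t∈
          E∩T : ∀ {i t} → i < suc q → t ∈ₛ edge T i → t ∉ₛ E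
          E∩T i< t∈T t∈E with avoid T i< t∈T (∈-++⁺ˡ (∈-++⁺ʳ W (∈-elements t∈E)))
          ... | inj₁ refl = c∉E t∈E
          ... | inj₂ refl = v∉E t∈E
          G∩T : ∀ {i t} → i < suc q → t ∈ₛ G → t ∈ₛ edge T i → t ≡ c
          G∩T i< t∈G t∈T with avoid T i< t∈T (∈-++⁺ʳ (W ++ elements E) (∈-elements t∈G))
          ... | inj₁ e = e
          ... | inj₂ refl = contradiction t∈G v∉G
          avoidT : ∀ {i t} → i < suc q → t ∈ₛ edge T i → t ∈ W → t ≡ v
          avoidT i< t∈ t∈W with avoid T i< t∈ (∈-++⁺ˡ (∈-++⁺ˡ t∈W))
          ... | inj₂ e = e
          ... | inj₁ refl = F″∩W c∈″ t∈W
          T′ : Path R L (suc (suc q)) b v W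
          T′ = consₚ T G∈ b∈G c∈G b≢v (λ v∈G → contradiction v∈G v∉G)
            (λ { i< t∈G t∈T → first T i< (subst (_∈ₛ edge T _) (G∩T i< t∈G t∈T) t∈T) , λ _ → G∩T i< t∈G t∈T })
            (λ i< b∈T → b≢c (G∩T i< b∈G b∈T))
            (λ t∈ t∈W → contradiction t∈W (G∩W t∈))
            avoidT

-- Centralized, small, or containing a cycle

module Outcome {n k : ℕ} (χ : Fin n → Fin k) (4≤k : 4 ≤ k) {s q : ℕ} (1≤q : 1 ≤ q) (s≥ : k * suc (suc q) ≤ s)
  {R : Family n} {P : List (Subset k)} (hom : Types.Homogeneous χ s R P)
  (rainbow : ∀ {F} → F ∈ R → Colouring.Rainbow χ F) where
  open Types χ
  open Rainbow
  open Homogeneous hom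
  open Structure χ

  1≤k : 1 ≤ k
  1≤k = ≤-trans (s≤s z≤n) 4≤k

  room₀ : k + suc q * k ≤ s
  room₀ = subst (_≤ s) (*-comm k (suc (suc q))) s≥

  2k<s : k + k < s
  2k<s = begin-strict
    k + k ≡⟨ cong (k +_) (+-identityʳ k) ⟨
    2 * k <⟨ m<n+m (2 * k) 1≤k ⟩
    3 * k ≤⟨ *-monoˡ-≤ k (s≤s (s≤s 1≤q)) ⟩
    suc (suc q) * k ≤⟨ room₀ ⟩
    s ∎
    where open ≤-Reasoning

  Cycles : Set
  Cycles = ContainsMinimalCycle (suc (suc q)) R × (5 ≤ k → ContainsLinearCycle (suc (suc q)) R)

  open PathBuilding χ using (module Build)
  -- Links have to be single vertices only for `5 ≤ k`; for `k = 4` a minimal cycle is enough.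
  open Build (5 ≤ k) 1≤k hom rainbow

  close : ∀ {x y t F} → F ∈ R → t ≢ x → t ≢ y →
    (∀ {u v} → u ∈ₛ F → χ u ≡ x → v ∈ₛ F → χ v ≡ y → Path R (5 ≤ k) (suc q) u v (elements F)) → Cycles
  close {x} {y} {t} F∈ t≢x t≢y path
    with u , u∈ , eu ← vertex (rainbow F∈) x
    with v , v∈ , ev ← vertex (rainbow F∈) y
    with w , w∈ , ew ← vertex (rainbow F∈) t
    = C.minimalCycle , C.linearCycle
    where module C = Closing (path u∈ eu v∈ ev) F∈ u∈ v∈ w∈ (≢-colours ew eu t≢x) (≢-colours ew ev t≢y)

  roomF : ∀ {F} → F ∈ R → length (elements F) + suc q * k ≤ s
  roomF {F} F∈ = subst (λ m → m + suc q * k ≤ s) (sym (trans (length-elements F) (size (rainbow F∈)))) room₀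

  linear-cycles : ∀ {F x y z A} → F ∈ R → x ≢ z → A ∈ P → x ∈ₛ A → z ∈ₛ A → y ∉ₛ A → pair x y ∈ P → pair z y ∈ P → Cycles
  linear-cycles F∈ x≢z A∈ x∈ z∈ y∉ xy∈ zy∈ = close F∈ (x≢z ∘ sym) (λ { refl → y∉ z∈ }) λ u∈ eu v∈ ev →
    linearPath A∈ y∉ q x≢z x∈ z∈ xy∈ zy∈ F∈ u∈ eu v∈ ev _ (roomF F∈)

  -- Each colour `e` off the pair is separated from it by `co e` or by `co₂ e d` with `d` off the
  -- pair too, so `⋂-closed` applies; `t` shows that the pair is not `full`.
  pair∈P : ∀ {F x y t} → F ∈ R → t ≢ x → t ≢ y →
    (∀ e → e ≢ x → e ≢ y → co e ∈ P ⊎ ∃[ d ] (d ≢ x × d ≢ y × co₂ e d ∈ P)) → pair x y ∈ P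
  pair∈P {x = x} {y} {t} F∈ t≢x t≢y sep = ⋂-closed hom rainbow 2k<s F∈ pair≢ separate
    where
    pair≢ : pair x y ≢ full
    pair≢ e = [ t≢x , t≢y ]′ (∈pair⁻ (subst (t ∈ₛ_) (sym e) ∈⊤))
    separate : ∀ {a} → a ∉ₛ pair x y → ∃[ B ] (B ∈ P × pair x y ⊆ B × a ∉ₛ B)
    separate {a} a∉ with sep a (λ { refl → a∉ (∈pairˡ x y) }) (λ { refl → a∉ (∈pairʳ x y) })
    ... | inj₁ co∈ = co a , co∈ , (λ c∈ → ∈co λ { refl → a∉ c∈ }) , λ a∈ → ∈co⁻ a∈ refl
    ... | inj₂ (d , d≢x , d≢y , co₂∈) = co₂ a d , co₂∈ ,
      (λ c∈ → ∈co₂ (λ { refl → a∉ c∈ }) (λ { refl → [ d≢x , d≢y ]′ (∈pair⁻ c∈) })) ,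
      λ a∈ → proj₁ (∈co₂⁻ {a = a} {d} a∈) refl

  module _ (co₂∈ : ∀ {a b} → a ≢ b → co a ∉ P → co b ∉ P → co₂ a b ∈ P) {F a b} (F∈ : F ∈ R)
    (a≢b : a ≢ b) (a∉ : co a ∉ P) (b∉ : co b ∉ P) where

    -- The paths alternate between `a` and `b` with end colour `y`. The type containing `a` and `b`
    -- but not `y` is `co y` if that lies in `P`, and otherwise `co₂ y t`.
    cycles-three : ∀ {t} → t ≢ a → t ≢ b → co t ∉ P → Cycles
    cycles-three {t} t≢a t≢b t∉ with y , y∉ ← unlisted (a ∷ b ∷ t ∷ []) 4≤k =
      by-type (co y ∈ᶠ? P)
      where
      y≢a : y ≢ a
      y≢a e = y∉ (here e)
      y≢b : y ≢ b
      y≢b e = y∉ (there (here e))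
      y≢t : y ≢ t
      y≢t e = y∉ (there (there (here e)))
      -- A colour whose complement is not in `P` is separated together with `b`, or together with
      -- `t` when it is `b` itself.
      pair∈ : ∀ {a b} → co b ∉ P → b ≢ a → t ≢ a → t ≢ b → y ≢ b → pair a y ∈ P
      pair∈ {a} {b} b∉ b≢a t≢a t≢b y≢b = pair∈P F∈ t≢a (y≢t ∘ sym) λ e _ _ → sep e (co e ∈ᶠ? P) (e ≟ᶠ b)
        where
        sep : ∀ e → Dec (co e ∈ P) → Dec (e ≡ b) → co e ∈ P ⊎ ∃[ d ] (d ≢ a × d ≢ y × co₂ e d ∈ P)
        sep e (yes e∈) _ = inj₁ e∈
        sep e (no e∉) (yes refl) = inj₂ (t , t≢a , y≢t ∘ sym , co₂∈ (t≢b ∘ sym) e∉ t∉)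
        sep e (no e∉) (no e≢b) = inj₂ (b , b≢a , y≢b ∘ sym , co₂∈ e≢b e∉ b∉)
      ay∈ = pair∈ b∉ (a≢b ∘ sym) t≢a t≢b y≢b
      by∈ = pair∈ a∉ a≢b t≢b t≢a y≢a
      by-type : Dec (co y ∈ P) → Cycles
      by-type (yes y∈) = linear-cycles F∈ a≢b y∈ (∈co (y≢a ∘ sym)) (∈co (y≢b ∘ sym)) (λ y∈co → ∈co⁻ y∈co refl) ay∈ by∈
      by-type (no y∉P) = linear-cycles F∈ a≢b (co₂∈ y≢t y∉P t∉)
        (∈co₂ (y≢a ∘ sym) (t≢a ∘ sym)) (∈co₂ (y≢b ∘ sym) (t≢b ∘ sym)) (λ y∈co → proj₁ (∈co₂⁻ {a = y} {t} y∈co) refl) ay∈ by∈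

    -- Every pair of colours avoiding `a` and `b` is in `P`, since `co₂ a b` separates both of them
    -- at once and `co e` separates any other colour.
    cycles-two : (∀ {e} → e ≢ a → e ≢ b → co e ∈ P) → Cycles
    cycles-two others
      with y , y∉ ← unlisted (a ∷ b ∷ []) (≤-trans (s≤s (s≤s (s≤s z≤n))) 4≤k)
      with x , x∉ ← unlisted (a ∷ b ∷ y ∷ []) 4≤k
      = by-size (5 ≤? k)
      where
      Other : Fin k → Set
      Other c = c ≢ a × c ≢ b
      y-other : Other y
      y-other = (λ e → y∉ (here e)) , (λ e → y∉ (there (here e)))
      x-other : Other x
      x-other = (λ e → x∉ (here e)) , (λ e → x∉ (there (here e)))
      x≢y : x ≢ y
      x≢y e = x∉ (there (there (here e)))
      pair∈ : ∀ {c d} → Other c → Other d → pair c d ∈ P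
      pair∈ {c} {d} (c≢a , c≢b) (d≢a , d≢b) = pair∈P F∈ (c≢a ∘ sym) (d≢a ∘ sym) λ e _ _ → sep e (e ≟ᶠ a) (e ≟ᶠ b)
        where
        sep : ∀ e → Dec (e ≡ a) → Dec (e ≡ b) → co e ∈ P ⊎ ∃[ f ] (f ≢ c × f ≢ d × co₂ e f ∈ P)
        sep e (yes refl) _ = inj₂ (b , c≢b ∘ sym , d≢b ∘ sym , co₂∈ a≢b a∉ b∉)
        sep e (no _) (yes refl) = inj₂ (a , c≢a ∘ sym , d≢a ∘ sym , co₂∈ (a≢b ∘ sym) b∉ a∉)
        sep e (no e≢a) (no e≢b) = inj₁ (others e≢a e≢b)
      y∈ = others (proj₁ y-other) (proj₂ y-other)
      by-size : Dec (5 ≤ k) → Cycles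
      -- Five colours leave three besides `a` and `b`: the paths alternate between `x` and `z` with
      -- end colour `y`.
      by-size (yes 5≤k) with z , z∉ ← unlisted (a ∷ b ∷ y ∷ x ∷ []) 5≤k =
        linear-cycles F∈ (λ e → z∉ (there (there (there (here (sym e)))))) y∈ (∈co x≢y)
          (∈co λ e → z∉ (there (there (here e)))) (λ y∈co → ∈co⁻ y∈co refl) (pair∈ x-other y-other)
          (pair∈ ((λ e → z∉ (here e)) , (λ e → z∉ (there (here e)))) y-other)
      -- Only `x` and `y` are guaranteed besides `a` and `b`, so nothing is left to alternate with
      -- `x`; the links use colour `a` as well.
      by-size (no 5≰k) = close F∈ (proj₁ x-other ∘ sym) (proj₁ y-other ∘ sym) λ u∈ eu v∈ ev →
        minimalPath 5≰k x≢y (proj₁ x-other ∘ sym) (proj₁ y-other ∘ sym) (pair∈ x-other y-other)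
          (others (proj₁ x-other) (proj₂ x-other)) y∈ q F∈ u∈ eu v∈ ev _ (roomF F∈)

  outcome : Unique R → ∀ {F} → F ∈ R → Centralized s R ⊎ length R ≤ n C (k ∸ 2) ⊎ Cycles
  outcome uR F∈ with any? (λ a → ¬? (co a ∈ᶠ? P))
  -- All complements are in `P`, so any colour can be the centre; colour 0 is taken.
  ... | no none = inj₁ (centralized hom rainbow 2k<s (fromℕ< 1≤k) λ {a} _ →
    decidable-stable (co a ∈ᶠ? P) λ a∉ → none (a , a∉))
  ... | yes (a , a∉) with any? (λ b → ¬? (a ≟ᶠ b) ×-dec ¬? (co b ∈ᶠ? P))
  ...   | no none = inj₁ (centralized hom rainbow 2k<s a λ {b} b≢a →
    decidable-stable (co b ∈ᶠ? P) λ b∉ → none (b , b≢a ∘ sym , b∉))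
  ...   | yes (b , a≢b , b∉)
    with any? (λ c → any? λ d → ¬? (c ≟ᶠ d) ×-dec ¬? (co c ∈ᶠ? P) ×-dec ¬? (co d ∈ᶠ? P) ×-dec ¬? (co₂ c d ∈ᶠ? P))
  ...     | yes (c , d , c≢d , c∉ , d∉ , cd∉) = inj₂ (inj₁ (own-subset-bound hom rainbow uR c≢d c∉ d∉ cd∉))
  ...     | no none with any? (λ t → ¬? (t ≟ᶠ a) ×-dec ¬? (t ≟ᶠ b) ×-dec ¬? (co t ∈ᶠ? P))
  ...       | yes (t , t≢a , t≢b , t∉) = inj₂ (inj₂ (cycles-three
    (λ {c} {d} c≢d c∉ d∉ → decidable-stable (co₂ c d ∈ᶠ? P) λ cd∉ → none (c , d , c≢d , c∉ , d∉ , cd∉))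
    F∈ a≢b a∉ b∉ t≢a t≢b t∉))
  ...       | no none′ = inj₂ (inj₂ (cycles-two
    (λ {c} {d} c≢d c∉ d∉ → decidable-stable (co₂ c d ∈ᶠ? P) λ cd∉ → none (c , d , c≢d , c∉ , d∉ , cd∉))
    F∈ a≢b a∉ b∉ λ {e} e≢a e≢b → decidable-stable (co e ∈ᶠ? P) λ e∉ → none′ (e , e≢a , e≢b , e∉)))

-- Peeling off centralized subfamilies

ContainsMinimalCycle-mono : ∀ {n ℓ} {𝓖 𝓗 : Family n} → (∀ {F} → F ∈ 𝓖 → F ∈ 𝓗) →
  ContainsMinimalCycle ℓ 𝓖 → ContainsMinimalCycle ℓ 𝓗
ContainsMinimalCycle-mono sub (F , v , F∈ , rest) = F , v , sub ∘ F∈ , rest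

ContainsLinearCycle-mono : ∀ {n ℓ} {𝓖 𝓗 : Family n} → (∀ {F} → F ∈ 𝓖 → F ∈ 𝓗) →
  ContainsLinearCycle ℓ 𝓖 → ContainsLinearCycle ℓ 𝓗
ContainsLinearCycle-mono sub (F , v , F∈ , rest) = F , v , sub ∘ F∈ , rest

properTypes : ∀ k → List (Subset k)
properTypes k = filter (λ A → ¬? (A ≟ₛ full)) (allSubsets k)

-- The first factor pays for passing to rainbow members, the second for cleaning all proper types.
constant : ℕ → ℕ → ℕ
constant k s = k ^ k * cleaningConstant k s (length (properTypes k))

CycleFree : ∀ {n} → ℕ → ℕ → Family n → Set
CycleFree k ℓ 𝓕 = (k ≡ 4 → ¬ ContainsMinimalCycle ℓ 𝓕) × (5 ≤ k → ¬ ContainsLinearCycle ℓ 𝓕)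

CycleFree-mono : ∀ {n k ℓ} {𝓖 𝓗 : Family n} → (∀ {F} → F ∈ 𝓖 → F ∈ 𝓗) → CycleFree k ℓ 𝓗 → CycleFree k ℓ 𝓖
CycleFree-mono sub (m , l) = (λ e → m e ∘ ContainsMinimalCycle-mono sub) , (λ e → l e ∘ ContainsLinearCycle-mono sub)

large-subfamily : ∀ {n} k s ℓ → 4 ≤ k → 3 ≤ ℓ → k * ℓ ≤ s → (𝓕 : Family n) → Unique 𝓕 → Uniform k 𝓕 → CycleFree k ℓ 𝓕 →
  ∃[ R ] ((∀ {F} → F ∈ R → F ∈ 𝓕) × length 𝓕 ≤ constant k s * length R × (Centralized s R ⊎ length R ≤ n C (k ∸ 2)))
large-subfamily {n} k@(suc k-1) s (suc (suc q)) 4≤k (s≤s (s≤s 1≤q)) s≥ 𝓕 uF unif (min-free , lin-free)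
  with χ , P? , rainbow , 𝓕≤ ← many-rainbow k-1 𝓕 unif
  with R , P , sub , uR , hom , ≤R ← Types.homogeneous-subfamily χ s (length (properTypes k)) (properTypes k) (filter P? 𝓕)
         ≤-refl (λ A∈ → proj₂ (∈-filter⁻ (λ A → ¬? (A ≟ₛ full)) {xs = allSubsets k} A∈)) rainbow (filter⁺ P? uF)
         -- Initially `P` holds all proper types, so there is nothing to check outside it.
         (λ {A} A≢ A∉ → contradiction (∈-filter⁺ (λ A → ¬? (A ≟ₛ full)) (∈-allSubsets A) A≢) A∉)
  = R , R⊆𝓕 , bound , result R R⊆𝓕 uR hom (λ F∈ → All-lookup rainbow (sub F∈))
  where
  open ≤-Reasoning
  c = cleaningConstant k s (length (properTypes k))
  R⊆𝓕 : ∀ {F} → F ∈ R → F ∈ 𝓕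
  R⊆𝓕 F∈ = proj₁ (∈-filter⁻ P? {xs = 𝓕} (sub F∈))
  bound : length 𝓕 ≤ k ^ k * c * length R
  bound = begin
    length 𝓕 ≤⟨ 𝓕≤ ⟩
    k ^ k * length (filter P? 𝓕) ≤⟨ *-monoʳ-≤ (k ^ k) ≤R ⟩
    k ^ k * (c * length R) ≡⟨ *-assoc (k ^ k) c (length R) ⟨
    k ^ k * c * length R ∎
  result : ∀ R → (∀ {F} → F ∈ R → F ∈ 𝓕) → Unique R → Types.Homogeneous χ s R P → (∀ {F} → F ∈ R → Colouring.Rainbow χ F) →
    Centralized s R ⊎ length R ≤ n C (k ∸ 2)
  result [] _ _ _ _ = inj₁ []
  result R@(_ ∷ _) sub uR hom rb with Outcome.outcome χ 4≤k 1≤q s≥ hom rb uR (here refl)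
  ... | inj₁ cen = inj₁ cen
  ... | inj₂ (inj₁ small) = inj₂ small
  ... | inj₂ (inj₂ (minimal , linear)) with m≤n⇒m<n∨m≡n 4≤k
  ...   | inj₁ 5≤k = contradiction (ContainsLinearCycle-mono sub (linear 5≤k)) (lin-free 5≤k)
  ...   | inj₂ e = contradiction (ContainsMinimalCycle-mono sub minimal) (min-free (sym e))

filter-++-∁-↭ : ∀ {A : Set} {P : A → Set} (P? : Decidable P) xs → filter P? xs ++ filter (¬? ∘ P?) xs ↭ xs
filter-++-∁-↭ P? [] = ↭-refl
filter-++-∁-↭ P? (x ∷ xs) with P? x
... | yes _ = prep x (filter-++-∁-↭ P? xs)
... | no _ = ↭-trans (shift x (filter P? xs) (filter (¬? ∘ P?) xs)) (prep x (filter-++-∁-↭ P? xs))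

-- Stars survive in larger families. The lists `X` and `R` have the same members, so kernels carry
-- over from `R` to `X`.
Centralized-++ : ∀ {n s} {R X Y : Family n} → Centralized s R →
  (∀ {F} → F ∈ X → F ∈ R) → (∀ {F} → F ∈ R → F ∈ X) → Centralized s Y → Centralized s (X ++ Y)
Centralized-++ {X = X} cR X⊆R R⊆X cY = All-++⁺
  (tabulate λ F∈ → let c , c∈ , ker = All-lookup cR (X⊆R F∈) in c , c∈ , λ D D⊂ c∈D → InKer-mono (∈-++⁺ˡ ∘ R⊆X) (ker D D⊂ c∈D))
  (All-map (λ (c , c∈ , ker) → c , c∈ , λ D D⊂ c∈D → InKer-mono (∈-++⁺ʳ X) (ker D D⊂ c∈D)) cY)

Partition : ∀ {n} → ℕ → ℕ → Family n → Set
Partition {n} s b 𝓕 = Σ (Family n) λ 𝓕₁ → Σ (Family n) λ 𝓕₀ → ((𝓕₁ ++ 𝓕₀) ↭ 𝓕) × Centralized s 𝓕₁ × length 𝓕₀ ≤ b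

-- A nonempty centralized `R` is split off and the rest is peeled further. When `R` is small
-- instead, the whole current family is at most `constant k s` times as large and becomes the
-- exceptional part.
peel : ∀ {n} k s ℓ → 4 ≤ k → 3 ≤ ℓ → k * ℓ ≤ s → ∀ N (𝓕 : Family n) → length 𝓕 ≤ N → Unique 𝓕 → Uniform k 𝓕 → CycleFree k ℓ 𝓕 →
  Partition s (constant k s * (n C (k ∸ 2))) 𝓕
peel k s ℓ 4≤k 3≤ℓ s≥ zero [] _ _ _ _ = [] , [] , ↭-refl , [] , z≤n
peel {n} k s ℓ 4≤k 3≤ℓ s≥ (suc N) 𝓕 𝓕≤ uF unif free with large-subfamily k s ℓ 4≤k 3≤ℓ s≥ 𝓕 uF unif free
... | R , _ , 𝓕≤R , inj₂ small = [] , 𝓕 , ↭-refl , [] , ≤-trans 𝓕≤R (*-monoʳ-≤ (constant k s) small)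
-- An empty `R` makes no progress, but the size comparison then shows that `𝓕` is empty.
... | [] , _ , 𝓕≤R , inj₁ _ = [] , 𝓕 , ↭-refl , [] , ≤-trans 𝓕≤R (*-monoʳ-≤ (constant k s) z≤n)
... | R@(F ∷ _) , R⊆𝓕 , _ , inj₁ cR
  with Y₁ , Y₀ , perm , cY , small ← peel k s ℓ 4≤k 3≤ℓ s≥ N (filter (¬? ∘ (_∈ᶠ? R)) 𝓕)
         (≤-pred (≤-trans (filter-notAll (¬? ∘ (_∈ᶠ? R)) 𝓕 (lose (R⊆𝓕 (here refl)) (λ ∉ → ∉ (here refl)))) 𝓕≤))
         (filter⁺ (¬? ∘ (_∈ᶠ? R)) uF)
         (tabulate λ G∈ → All-lookup unif (proj₁ (∈-filter⁻ (¬? ∘ (_∈ᶠ? R)) G∈)))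
         (CycleFree-mono (λ G∈ → proj₁ (∈-filter⁻ (¬? ∘ (_∈ᶠ? R)) {xs = 𝓕} G∈)) free)
  = X ++ Y₁ , Y₀ ,
    ↭-trans (↭-reflexive (++-assoc X Y₁ Y₀)) (↭-trans (++⁺ˡ X perm) (filter-++-∁-↭ (_∈ᶠ? R) 𝓕)) ,
    Centralized-++ cR (λ G∈ → proj₂ (∈-filter⁻ (_∈ᶠ? R) {xs = 𝓕} G∈)) (λ G∈ → ∈-filter⁺ (_∈ᶠ? R) (R⊆𝓕 G∈) G∈) cY ,
    small
  where
  X = filter (_∈ᶠ? R) 𝓕

constant≥1 : ∀ k s → 1 ≤ k → 1 ≤ constant k s
constant≥1 (suc k-1) s _ = *-mono-≤ {x = 1} {u = 1} (m^n>0 (suc k-1) (suc k-1)) (cleaningConstant≥1 (suc k-1) s (length (properTypes (suc k-1))))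

theorem8p2 : (k s : ℕ) → 4 ≤ k → ∃[ K ] (1 ≤ K × ((ℓ : ℕ) → 3 ≤ ℓ → k * ℓ ≤ s → (n : ℕ) → (𝓕 : Family n) → Unique 𝓕 → Uniform k 𝓕 → (k ≡ 4 → ¬ ContainsMinimalCycle ℓ 𝓕) → (5 ≤ k → ¬ ContainsLinearCycle ℓ 𝓕) → Σ (Family n) λ 𝓕₁ → Σ (Family n) λ 𝓕₀ → ((𝓕₁ ++ 𝓕₀) ↭ 𝓕) × Centralized s 𝓕₁ × length 𝓕₀ ≤ K * (n C (k ∸ 2))))
theorem8p2 k s 4≤k = constant k s , constant≥1 k s (≤-trans (s≤s z≤n) 4≤k) ,
  λ ℓ 3≤ℓ s≥ n 𝓕 uF unif minimal linear → peel k s ℓ 4≤k 3≤ℓ s≥ (length 𝓕) 𝓕 ≤-refl uF unif (minimal , linear)
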